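{- Let $a=(a_k)_{k\ge1}$ be a sequence of complex numbers with $a_1=0$. For integers $k>l\ge0$ let $Q_{(k,l);a}$ be the multiparameter Schur Q-function of the strict partition $(k,l)$ (equal to $Q_{(k);a}$ if $l=0$), and for $0\le k\le l$ put $Q_{(k,l);a}=-Q_{(l,k);a}$. Let $\lambda$ be a strict partition and set $\lambda_{\ell(\lambda)+1}=0$. Then $$Q_{\lambda;a}=\operatorname{Pf}\Bigl(\bigl(Q_{(\lambda_i,\lambda_j);a}\bigr)_{1\le i,j\le 2[\frac{\ell(\lambda)+1}{2}]}\Bigr),$$ where $[x]$ denotes the integral part of $x$.
   Context: Put $(x\mid a)^k=\prod_{m=1}^k(x-a_m)$, $(x\mid a)^0=1$. For a strict partition $\lambda=(\lambda_1>\dots>\lambda_l>0)$, $\ell(\lambda)=l$, and $m\ge l$, $$P_{\lambda;a}(x_1,\dots,x_m)=\frac1{(m-l)!}\sum_{\omega\in S(m)}\prod_{i=1}^l (x_{\omega(i)}\mid a)^{\lambda_i}\prod_{1\le i\le l,\ i<j\le m}\frac{x_{\omega(i)}+x_{\omega(j)}}{x_{\omega(i)}-x_{\omega(j)}},$$ and $0$ if $m<l$; these form a stable sequence (under $x_{m+1}\mapsto0$) of supersymmetric polynomials, i.e. an element $P_{\lambda;a}$ of the algebra $\Gamma$ of supersymmetric functions, and $Q_{\lambda;a}=2^{\ell(\lambda)}P_{\lambda;a}$. The Pfaffian of a skew-symmetric $2m\times2m$ matrix $A=(a_{ij})$ is $\sum_{\omega}\operatorname{sgn}(\omega)\prod_{i=1}^m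 a_{\omega(2i-1)\omega(2i)}$ over $\omega\in S(2m)$ with $\omega(2i-1)<\omega(2i)$ and $\omega(1)<\omega(3)<\dots<\omega(2m-1)$. -}

module Defs where

open import Level using (Level)
open import Data.Bool using (Bool; true; false; if_then_else_; _∧_; not)
open import Data.Nat using (ℕ; zero; suc; _<ᵇ_; _≡ᵇ_; _≤ᵇ_; _∸_; _^_; _<_; _!)

open import Data.Fin using (Fin; toℕ)
open import Data.List using (List; []; _∷_; [_]; map; foldr; concatMap; allFin; filterᵇ; length)
open import Data.List.Relation.Unary.All using (All)
open import Data.List.Relation.Unary.Linked using (Linked)
open import Data.Product using (_×_)
open import Algebra.Bundles using (CommutativeRing)
import Data.Vec.Functional as VF

-- i-th entry of a list of naturals (0-based), 0 beyond the end.
-- For a partition λ, (nth λ i) is λ_{i+1}, with λ_{ℓ(λ)+1} = 0 etc.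
nth : List ℕ → ℕ → ℕ
nth []       _       = 0
nth (x ∷ xs) zero    = x
nth (x ∷ xs) (suc i) = nth xs i

StrictPartition : List ℕ → Set
StrictPartition μ = Linked (λ p q → q < p) μ × All (λ k → 0 < k) μ

allFuns : ∀ n k → List (Fin n → Fin k)
allFuns zero    k = [ (λ ()) ]
allFuns (suc n) k =
  concatMap (λ f → map (λ c → c VF.∷ f) (allFin k)) (allFuns n k)

allᵇ : ∀ {A : Set} → (A → Bool) → List A → Bool
allᵇ p = foldr (λ a b → p a ∧ b) true

isInjᵇ : ∀ {n} → (Fin n → Fin n) → Bool
isInjᵇ {n} ω = allᵇ (λ i → allᵇ (λ j →
  if toℕ i <ᵇ toℕ j then not (toℕ (ω i) ≡ᵇ toℕ (ω j)) else true)
  (allFin n)) (allFin n)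

perms : ∀ n → List (Fin n → Fin n)
perms n = filterᵇ isInjᵇ (allFuns n n)

inversions : ∀ {n} → (Fin n → Fin n) → ℕ
inversions {n} ω = foldr Data.Nat._+_ 0 (concatMap (λ i → map (λ j →
  if (toℕ i <ᵇ toℕ j) ∧ (toℕ (ω j) <ᵇ toℕ (ω i)) then 1 else 0)
  (allFin n)) (allFin n))

-- ω as a function on ℕ (0-based positions, 0 outside the range)
asℕ : ∀ {n} → (Fin n → Fin n) → ℕ → ℕ
asℕ {n} ω k = nth (map (λ i → toℕ (ω i)) (allFin n)) k

pfCondᵇ : ∀ {n} → ℕ → (Fin n → Fin n) → Bool
pfCondᵇ h ω = allᵇ (λ i → asℕ ω (2 Data.Nat.* i) <ᵇ asℕ ω (suc (2 Data.Nat.* i)))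
                   (map toℕ (allFin h))
            ∧ allᵇ (λ i → if suc i <ᵇ h
                            then asℕ ω (2 Data.Nat.* i) <ᵇ asℕ ω (2 Data.Nat.* suc i)
                            else true)
                   (map toℕ (allFin h))

module _ {c ℓ : Level} (R : CommutativeRing c ℓ) where
  open CommutativeRing R

  fromℕ : ℕ → Carrier
  fromℕ zero    = 0#
  fromℕ (suc n) = 1# + fromℕ n

  Σ : ∀ {A : Set} → List A → (A → Carrier) → Carrier
  Σ xs f = foldr (λ a s → f a + s) 0# xs

  Π : ∀ {A : Set} → List A → (A → Carrier) → Carrier
  Π xs f = foldr (λ a s → f a * s) 1# xs

  signPow : ℕ → Carrier
  signPow zero    = 1#
  signPow (suc k) = - signPow k

  Pf : (h : ℕ) → (ℕ → ℕ → Carrier) → Carrier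
  Pf h A = Σ (filterᵇ (pfCondᵇ h) (perms (2 Data.Nat.* h))) (λ ω →
             signPow (inversions ω) *
             Π (map toℕ (allFin h)) (λ i →
                A (asℕ ω (2 Data.Nat.* i)) (asℕ ω (suc (2 Data.Nat.* i)))))

  module _ (inv : Carrier → Carrier) (a : ℕ → Carrier) where

    factPow : Carrier → ℕ → Carrier
    factPow x zero    = 1#
    factPow x (suc k) = factPow x k * (x - a (suc k))

    Pval : List ℕ → (m : ℕ) → (Fin m → Carrier) → Carrier
    Pval μ m x =
      if length μ ≤ᵇ m
      then inv (fromℕ ((m ∸ length μ) !)) *
           Σ (perms m) (λ ω →
             Π (allFin m) (λ i →
               if toℕ i <ᵇ length μ
               then factPow (x (ω i)) (nth μ (toℕ i)) *
                    Π (allFin m) (λ j →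
                      if toℕ i <ᵇ toℕ j
                      then (x (ω i) + x (ω j)) * inv (x (ω i) - x (ω j))
                      else 1#)
               else 1#))
      else 0#

    Qval : List ℕ → (m : ℕ) → (Fin m → Carrier) → Carrier
    Qval μ m x = fromℕ (2 ^ length μ) * Pval μ m x

    Qpair : ℕ → ℕ → (m : ℕ) → (Fin m → Carrier) → Carrier
    Qpair k l m x =
      if l <ᵇ k then Qval (if l ≡ᵇ 0 then [ k ] else k ∷ l ∷ []) m x
      else if k <ᵇ l then - Qval (if k ≡ᵇ 0 then [ l ] else l ∷ k ∷ []) m x
      else 0#

{-# OPTIONS --safe #-}
module Submission where

-- With e_uv = (x_u + x_v)/(x_u − x_v), the summand of Q_λ attached to an injection f of the rows
-- of λ into the variables is, up to weights depending on single rows, ∏_{i<j} e_{f(i)f(j)} times the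
-- product of the e_{f(i)k} over the unused variables k. By multilinearity the Pfaffian of the
-- Q_(λi,λj) is the sum over all maps f of the same weights times Pf B_{f(i)f(j)}, where
-- B_uv = e_uv ∏_{k≠u,v} e_uk e_vk. This Pfaffian vanishes when f is not injective, and otherwise
-- it is evaluated by the expansion along the first row, which reduces Schur's Pfaffian to
-- ∑_j ∏_{k≠j} e_zk e_jk = 1 for an odd number of indices j; that identity follows by induction
-- from the addition formula e_uv e_vw + e_vw e_wu + e_wu e_uv = −1.

open import Defs
open import Level using (Level)
open import Data.Bool using (Bool; true; false; if_then_else_; _∧_; not)
import Data.Bool as Bool
open import Data.Empty using (⊥-elim)
open import Data.Fin using (Fin; toℕ; zero; suc)
import Data.Fin.Properties as Fin
open import Data.Integer using (ℤ; +_; -[1+_]; _⊖_)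
import Data.Integer as ℤ
import Data.Integer.Properties as ℤ
open import Data.List using (List; []; _∷_; [_]; _++_; map; concatMap; allFin; tabulate; filterᵇ; length)
import Data.List.Properties as List
open import Data.List.Membership.Propositional using (_∈_)
open import Data.List.Membership.Propositional.Properties using (∈-∃++; ∈-map⁺; ∈-++⁺ˡ)
open import Data.List.Relation.Unary.Any using (here; there)
open import Data.List.Relation.Unary.All as All using (All; []; _∷_)
import Data.List.Relation.Unary.All.Properties as All
open import Data.List.Relation.Unary.AllPairs as AllPairs using (AllPairs; []; _∷_)
open import Data.List.Relation.Unary.Linked.Properties using (Linked⇒AllPairs)
open import Data.List.Relation.Unary.Unique.Propositional using (Unique)
import Data.List.Relation.Unary.Unique.Propositional.Properties as Unique
open import Data.List.Relation.Binary.Permutation.Propositional as ↭ using (_↭_; ↭-sym; ↭-trans; prep; swap)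
open import Data.List.Relation.Binary.Permutation.Propositional.Properties using (shift; All-resp-↭; ∈-resp-↭; ↭-length; drop-∷; ↭-map-inv; map⁺; ++⁺ʳ; ∷↭∷ʳ)
import Data.List.Relation.Binary.Permutation.Setoid.Properties as ↭ₛ
open import Data.Maybe using (Maybe; just; nothing)
import Data.Maybe.Properties as Maybe
open import Data.Nat using (ℕ; zero; suc; _≡ᵇ_; _<ᵇ_; _≤ᵇ_; _<_; _≤_; z≤n; s≤s; _!; _^_; _/_; _∸_)
import Data.Nat as ℕ
import Data.Nat.Properties as ℕ
open import Data.Nat.DivMod using (m/n≡1+[m∸n]/n)
open import Data.Nat.ListAction using (sum)
open import Data.Nat.ListAction.Properties using (sum-++; sum-↭)
open import Data.Product using (_,_; _×_; ∃)
open import Data.Sum using (_⊎_; inj₁; inj₂)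
import Data.Vec.Functional as VF
open import Function using (_∘_)
open import Relation.Nullary using (¬_; yes; no)
open import Relation.Binary.Construct.Closure.ReflexiveTransitive using (Star; ε; _◅_; _◅◅_; gmap)
open import Relation.Binary.PropositionalEquality as ≡ using (_≡_; _≢_; cong; cong₂)
open import Algebra.Bundles using (CommutativeRing)
open import Algebra.Solver.Ring.AlmostCommutativeRing using (fromCommutativeRing; _-Raw-AlmostCommutative⟶_)
import Algebra.Solver.Ring
import Algebra.Properties.Ring
import Algebra.Properties.AbelianGroup
import Algebra.Properties.Semiring.Mult.TCOptimised

-- The matrix B comes from Schur's Pfaffian with entries 1/e_uv: multiplying row and column u by c_u
-- = ∏_{k≠u} e_uk turns 1/e_uv into -B_uv. The rescaled entry keeps its meaning when x_u + x_v = 0,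
-- where e_uv has no inverse, so the evaluation is carried out for B directly. No separate formula
-- for Q_(k,l) is required. Evaluated on one or two rows, the Pfaffian of B already says that
-- Q_(k,l) is the bilinear form of B in the weights of the rows k and l; evaluated on all rows it
-- gives Q_λ. One computation supplies both the entries and the result. The sum must run over all
-- maps because multilinearity lets every row choose its variable independently. A map that hits a
-- variable twice yields a Pfaffian with a repeated index; alternation gives only 2 Pf = 0, and 2 is
-- invertible. For odd length the row of the part 0 is sent to an extra point that stands for the
-- variable 0. Its values e = ±1 are assigned and not computed, since some x_u may itself be 0;
-- skewness and the addition formula persist, and the evaluation rests on these alone.

module ℤSolver {c ℓ : Level} (R : CommutativeRing c ℓ) where
  open CommutativeRing R hiding (zero)
  open Algebra.Properties.Ring ring using (-‿distribˡ-*; -‿involutive; -0#≈0#)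
  open Algebra.Properties.AbelianGroup +-abelianGroup using (⁻¹-∙-comm)
  open Algebra.Properties.Semiring.Mult.TCOptimised semiring using (×-homo-+; ×1-homo-*) renaming (_×_ to _·_)
  open import Relation.Binary.Reasoning.Setoid setoid

  -- Equality in `Carrier` cannot be decided, so the ring solver takes its coefficients from ℤ and
  -- sees cancellations such as 1 - 1 over every commutative ring.
  ⟦_⟧ℤ : ℤ → Carrier
  ⟦ + n ⟧ℤ      = n · 1#
  ⟦ -[1+ n ] ⟧ℤ = - (suc n · 1#)

  neg-homo : ∀ i → ⟦ ℤ.- i ⟧ℤ ≈ - ⟦ i ⟧ℤ
  neg-homo (+ zero)  = sym -0#≈0#
  neg-homo (+ suc n) = refl
  neg-homo -[1+ n ]  = sym (-‿involutive _)

  suc-homo : ∀ n → suc n · 1# ≈ 1# + n · 1#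
  suc-homo n = ×-homo-+ 1# 1 n

  ⊖-homo : ∀ m n → ⟦ m ⊖ n ⟧ℤ ≈ m · 1# - n · 1#
  ⊖-homo m       zero    = sym (trans (+-congˡ -0#≈0#) (+-identityʳ _))
  ⊖-homo zero    (suc n) = sym (+-identityˡ _)
  ⊖-homo (suc m) (suc n) = begin
    ⟦ suc m ⊖ suc n ⟧ℤ                    ≡⟨ ≡.cong ⟦_⟧ℤ (ℤ.[1+m]⊖[1+n]≡m⊖n m n) ⟩
    ⟦ m ⊖ n ⟧ℤ                            ≈⟨ ⊖-homo m n ⟩
    m · 1# - n · 1#                       ≈⟨ +-congʳ (+-identityˡ _) ⟨
    0# + m · 1# - n · 1#                  ≈⟨ +-congʳ (+-congʳ (-‿inverseʳ 1#)) ⟨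
    1# - 1# + m · 1# - n · 1#             ≈⟨ +-congʳ (trans (+-assoc _ _ _) (trans (+-congˡ (+-comm _ _)) (sym (+-assoc _ _ _)))) ⟩
    1# + m · 1# - 1# - n · 1#             ≈⟨ +-assoc _ _ _ ⟩
    1# + m · 1# + (- 1# - n · 1#)         ≈⟨ +-cong (sym (suc-homo m)) (trans (⁻¹-∙-comm _ _) (-‿cong (sym (suc-homo n)))) ⟩
    suc m · 1# - suc n · 1#               ∎

  +-homo : ∀ i j → ⟦ i ℤ.+ j ⟧ℤ ≈ ⟦ i ⟧ℤ + ⟦ j ⟧ℤ
  +-homo (+ m)    (+ n)    = ×-homo-+ 1# m n
  +-homo (+ m)    -[1+ n ] = ⊖-homo m (suc n)
  +-homo -[1+ m ] (+ n)    = trans (⊖-homo n (suc m)) (+-comm _ _)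
  +-homo -[1+ m ] -[1+ n ] = begin
    - (suc (suc (m ℕ.+ n)) · 1#)   ≡⟨ ≡.cong (λ k → - (k · 1#)) (≡.cong suc (ℕ.+-suc m n)) ⟨
    - ((suc m ℕ.+ suc n) · 1#)     ≈⟨ -‿cong (×-homo-+ 1# (suc m) (suc n)) ⟩
    - (suc m · 1# + suc n · 1#)    ≈⟨ ⁻¹-∙-comm _ _ ⟨
    - (suc m · 1#) - (suc n · 1#)  ∎

  *-homo-pos : ∀ m j → ⟦ + m ℤ.* j ⟧ℤ ≈ m · 1# * ⟦ j ⟧ℤ
  *-homo-pos m (+ n)    = trans (reflexive (≡.cong ⟦_⟧ℤ (≡.sym (ℤ.pos-* m n)))) (×1-homo-* m n)
  *-homo-pos m -[1+ n ] = begin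
    ⟦ + m ℤ.* -[1+ n ] ⟧ℤ          ≡⟨ ≡.cong ⟦_⟧ℤ (ℤ.neg-distribʳ-* (+ m) (+ suc n)) ⟨
    ⟦ ℤ.- (+ m ℤ.* + suc n) ⟧ℤ     ≈⟨ neg-homo (+ m ℤ.* + suc n) ⟩
    - ⟦ + m ℤ.* + suc n ⟧ℤ         ≈⟨ -‿cong (*-homo-pos m (+ suc n)) ⟩
    - (m · 1# * (suc n · 1#))      ≈⟨ Algebra.Properties.Ring.-‿distribʳ-* ring _ _ ⟩
    m · 1# * - (suc n · 1#)        ∎

  *-homo : ∀ i j → ⟦ i ℤ.* j ⟧ℤ ≈ ⟦ i ⟧ℤ * ⟦ j ⟧ℤ
  *-homo (+ m)    j = *-homo-pos m j
  *-homo -[1+ m ] j = begin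
    ⟦ -[1+ m ] ℤ.* j ⟧ℤ         ≡⟨ ≡.cong ⟦_⟧ℤ (ℤ.neg-distribˡ-* (+ suc m) j) ⟨
    ⟦ ℤ.- (+ suc m ℤ.* j) ⟧ℤ    ≈⟨ neg-homo (+ suc m ℤ.* j) ⟩
    - ⟦ + suc m ℤ.* j ⟧ℤ        ≈⟨ -‿cong (*-homo-pos (suc m) j) ⟩
    - (suc m · 1# * ⟦ j ⟧ℤ)     ≈⟨ -‿distribˡ-* _ _ ⟩
    - (suc m · 1#) * ⟦ j ⟧ℤ     ∎

  ℤ-morphism : CommutativeRing.rawRing ℤ.+-*-commutativeRing -Raw-AlmostCommutative⟶ fromCommutativeRing R
  ℤ-morphism = record
    { ⟦_⟧    = ⟦_⟧ℤ
    ; +-homo = +-homo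
    ; *-homo = *-homo
    ; -‿homo = neg-homo
    ; 0-homo = refl
    ; 1-homo = refl
    }

  coeff≟ : ∀ i j → Maybe (⟦ i ⟧ℤ ≈ ⟦ j ⟧ℤ)
  coeff≟ i j with i ℤ.≟ j
  ... | yes ≡.refl = just refl
  ... | no  _      = nothing

  open Algebra.Solver.Ring _ _ ℤ-morphism coeff≟ public
    using (solve; _:=_; _:+_; _:*_; _:-_; :-_; con)

-- Duplicate-free lists and their Boolean test.

Unique-resp-↭ : ∀ {A : Set} {xs ys : List A} → xs ↭ ys → Unique xs → Unique ys
Unique-resp-↭ p = ↭ₛ.Unique-resp-↭ (≡.setoid _) (↭.↭⇒↭ₛ p)

neqᵇ : ∀ {k} → Fin k → Fin k → Bool
neqᵇ u v = not (toℕ u ≡ᵇ toℕ v)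

uniqᵇ : ∀ {k} → List (Fin k) → Bool
uniqᵇ []       = true
uniqᵇ (u ∷ us) = allᵇ (neqᵇ u) us ∧ uniqᵇ us

neqᵇ-refl : ∀ {k} (u : Fin k) → neqᵇ u u ≡ false
neqᵇ-refl u with toℕ u ≡ᵇ toℕ u | ℕ.≡⇒≡ᵇ (toℕ u) (toℕ u) ≡.refl
... | true | _ = ≡.refl

neqᵇ-≢ : ∀ {k} {u v : Fin k} → u ≢ v → neqᵇ u v ≡ true
neqᵇ-≢ {u = u} {v} u≢v with toℕ u ≡ᵇ toℕ v | ℕ.≡ᵇ⇒≡ (toℕ u) (toℕ v)
... | true  | f = ⊥-elim (u≢v (Fin.toℕ-injective (f _)))
... | false | _ = ≡.refl

if-∧ : ∀ {a} {A : Set a} (b b′ : Bool) {x y : A} →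
       (if b ∧ b′ then x else y) ≡ (if b then (if b′ then x else y) else y)
if-∧ true  b′ = ≡.refl
if-∧ false b′ = ≡.refl

-- Finite sums and products, and sums over selections from a list.

module Sums {c ℓ : Level} (R : CommutativeRing c ℓ) where
  open CommutativeRing R hiding (zero)
  open ℤSolver R public
  open import Relation.Binary.Reasoning.Setoid setoid
  private variable A B : Set

  ∑ ∏ : List A → (A → Carrier) → Carrier
  ∑ = Σ R
  ∏ = Π R

  ∑-cong-All : ∀ {xs : List A} {f g} → All (λ x → f x ≈ g x) xs → ∑ xs f ≈ ∑ xs g
  ∑-cong-All []       = refl
  ∑-cong-All (p ∷ ps) = +-cong p (∑-cong-All ps)

  ∑-cong : ∀ (xs : List A) {f g} → (∀ x → f x ≈ g x) → ∑ xs f ≈ ∑ xs g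
  ∑-cong xs p = ∑-cong-All (All.universal p xs)

  ∏-cong-All : ∀ {xs : List A} {f g} → All (λ x → f x ≈ g x) xs → ∏ xs f ≈ ∏ xs g
  ∏-cong-All []       = refl
  ∏-cong-All (p ∷ ps) = *-cong p (∏-cong-All ps)

  ∏-cong : ∀ (xs : List A) {f g} → (∀ x → f x ≈ g x) → ∏ xs f ≈ ∏ xs g
  ∏-cong xs p = ∏-cong-All (All.universal p xs)

  ∑-0 : ∀ (xs : List A) → ∑ xs (λ _ → 0#) ≈ 0#
  ∑-0 []       = refl
  ∑-0 (x ∷ xs) = trans (+-identityˡ _) (∑-0 xs)

  ∏-1 : ∀ (xs : List A) → ∏ xs (λ _ → 1#) ≈ 1#
  ∏-1 []       = refl
  ∏-1 (x ∷ xs) = trans (*-identityˡ _) (∏-1 xs)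

  ∑-*ˡ : ∀ k (xs : List A) f → k * ∑ xs f ≈ ∑ xs (λ x → k * f x)
  ∑-*ˡ k []       f = zeroʳ k
  ∑-*ˡ k (x ∷ xs) f = trans (distribˡ _ _ _) (+-congˡ (∑-*ˡ k xs f))

  ∑-+ : ∀ (xs : List A) f g → ∑ xs (λ x → f x + g x) ≈ ∑ xs f + ∑ xs g
  ∑-+ []       f g = sym (+-identityˡ _)
  ∑-+ (x ∷ xs) f g = trans (+-congˡ (∑-+ xs f g))
    (solve 4 (λ a b c d → (a :+ b) :+ (c :+ d) := (a :+ c) :+ (b :+ d)) refl _ _ _ _)

  ∏-* : ∀ (xs : List A) f g → ∏ xs (λ x → f x * g x) ≈ ∏ xs f * ∏ xs g
  ∏-* []       f g = sym (*-identityˡ _)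
  ∏-* (x ∷ xs) f g = trans (*-congˡ (∏-* xs f g))
    (solve 4 (λ a b c d → (a :* b) :* (c :* d) := (a :* c) :* (b :* d)) refl _ _ _ _)

  ∑-neg : ∀ (xs : List A) f → ∑ xs (λ x → - f x) ≈ - ∑ xs f
  ∑-neg []       f = solve 0 (con (+ 0) := :- con (+ 0)) refl
  ∑-neg (x ∷ xs) f = trans (+-congˡ (∑-neg xs f))
    (solve 2 (λ a b → :- a :+ :- b := :- (a :+ b)) refl _ _)

  ∑-++ : ∀ (xs ys : List A) f → ∑ (xs ++ ys) f ≈ ∑ xs f + ∑ ys f
  ∑-++ []       ys f = sym (+-identityˡ _)
  ∑-++ (x ∷ xs) ys f = trans (+-congˡ (∑-++ xs ys f)) (sym (+-assoc _ _ _))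

  ∏-++ : ∀ (xs ys : List A) f → ∏ (xs ++ ys) f ≈ ∏ xs f * ∏ ys f
  ∏-++ []       ys f = sym (*-identityˡ _)
  ∏-++ (x ∷ xs) ys f = trans (*-congˡ (∏-++ xs ys f)) (sym (*-assoc _ _ _))

  ∑-map : ∀ (h : A → B) xs f → ∑ (map h xs) f ≈ ∑ xs (f ∘ h)
  ∑-map h []       f = refl
  ∑-map h (x ∷ xs) f = +-congˡ (∑-map h xs f)

  ∏-map : ∀ (h : A → B) xs f → ∏ (map h xs) f ≈ ∏ xs (f ∘ h)
  ∏-map h []       f = refl
  ∏-map h (x ∷ xs) f = *-congˡ (∏-map h xs f)

  ∑-concatMap : ∀ (h : A → List B) xs f → ∑ (concatMap h xs) f ≈ ∑ xs (λ x → ∑ (h x) f)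
  ∑-concatMap h []       f = refl
  ∑-concatMap h (x ∷ xs) f = trans (∑-++ (h x) _ f) (+-congˡ (∑-concatMap h xs f))

  ∑-filter : ∀ (p : A → Bool) xs f →
             ∑ (filterᵇ p xs) f ≈ ∑ xs (λ x → if p x then f x else 0#)
  ∑-filter p []       f = refl
  ∑-filter p (x ∷ xs) f with p x
  ... | true  = +-congˡ (∑-filter p xs f)
  ... | false = trans (∑-filter p xs f) (sym (+-identityˡ _))

  ∑-swap : ∀ (xs : List A) (ys : List B) (f : A → B → Carrier) →
           ∑ xs (λ x → ∑ ys (f x)) ≈ ∑ ys (λ y → ∑ xs (λ x → f x y))
  ∑-swap []       ys f = sym (∑-0 ys)
  ∑-swap (x ∷ xs) ys f = trans (+-congˡ (∑-swap xs ys f)) (sym (∑-+ ys _ _))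

  ∑-↭ : ∀ {xs ys : List A} f → xs ↭ ys → ∑ xs f ≈ ∑ ys f
  ∑-↭ f ↭.refl        = refl
  ∑-↭ f (prep x p)    = +-congˡ (∑-↭ f p)
  ∑-↭ f (swap x y p)  = trans (+-congˡ (+-congˡ (∑-↭ f p)))
    (solve 3 (λ a b c → a :+ (b :+ c) := b :+ (a :+ c)) refl _ _ _)
  ∑-↭ f (↭.trans p q) = trans (∑-↭ f p) (∑-↭ f q)

  ∏-↭ : ∀ {xs ys : List A} f → xs ↭ ys → ∏ xs f ≈ ∏ ys f
  ∏-↭ f ↭.refl        = refl
  ∏-↭ f (prep x p)    = *-congˡ (∏-↭ f p)
  ∏-↭ f (swap x y p)  = trans (*-congˡ (*-congˡ (∏-↭ f p)))
    (solve 3 (λ a b c → a :* (b :* c) := b :* (a :* c)) refl _ _ _)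
  ∏-↭ f (↭.trans p q) = trans (∏-↭ f p) (∏-↭ f q)

  -- selΣ xs F and altΣ xs F sum F y ys over all ways of picking an entry y of xs,
  -- ys being what remains; altΣ alternates signs with the position of y.
  selΣ altΣ : List A → (A → List A → Carrier) → Carrier
  selΣ []       F = 0#
  selΣ (x ∷ xs) F = F x xs + selΣ xs (λ y ys → F y (x ∷ ys))
  altΣ []       F = 0#
  altΣ (x ∷ xs) F = F x xs - altΣ xs (λ y ys → F y (x ∷ ys))

  private
    reinsert : ∀ {x y : A} {xs ys} → y ∷ ys ↭ xs → y ∷ x ∷ ys ↭ x ∷ xs
    reinsert {x = x} {y} p = ↭-trans (swap y x ↭.refl) (prep x p)

  selΣ-cong : ∀ (xs : List A) {F G} → (∀ y ys → y ∷ ys ↭ xs → F y ys ≈ G y ys) →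
              selΣ xs F ≈ selΣ xs G
  selΣ-cong []       p = refl
  selΣ-cong (x ∷ xs) p = +-cong (p x xs ↭.refl) (selΣ-cong xs λ y ys q → p y (x ∷ ys) (reinsert q))

  altΣ-cong : ∀ (xs : List A) {F G} → (∀ y ys → y ∷ ys ↭ xs → F y ys ≈ G y ys) →
              altΣ xs F ≈ altΣ xs G
  altΣ-cong []       p = refl
  altΣ-cong (x ∷ xs) p = +-cong (p x xs ↭.refl)
    (-‿cong (altΣ-cong xs λ y ys q → p y (x ∷ ys) (reinsert q)))

  selΣ-*ˡ : ∀ k (xs : List A) F → k * selΣ xs F ≈ selΣ xs (λ y ys → k * F y ys)
  selΣ-*ˡ k []       F = zeroʳ k
  selΣ-*ˡ k (x ∷ xs) F = trans (distribˡ _ _ _) (+-congˡ (selΣ-*ˡ k xs _))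

  selΣ-+ : ∀ (xs : List A) F G → selΣ xs (λ y ys → F y ys + G y ys) ≈ selΣ xs F + selΣ xs G
  selΣ-+ []       F G = sym (+-identityˡ _)
  selΣ-+ (x ∷ xs) F G = trans (+-congˡ (selΣ-+ xs _ _))
    (solve 4 (λ a b c d → (a :+ b) :+ (c :+ d) := (a :+ c) :+ (b :+ d)) refl _ _ _ _)

  selΣ-∑ : ∀ (xs : List A) f → selΣ xs (λ y _ → f y) ≈ ∑ xs f
  selΣ-∑ []       f = refl
  selΣ-∑ (x ∷ xs) f = +-congˡ (selΣ-∑ xs f)

  altΣ-*ˡ : ∀ k (xs : List A) F → k * altΣ xs F ≈ altΣ xs (λ y ys → k * F y ys)
  altΣ-*ˡ k []       F = zeroʳ k
  altΣ-*ˡ k (x ∷ xs) F = trans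
    (solve 3 (λ k a b → k :* (a :- b) := k :* a :- k :* b) refl _ _ _)
    (+-congˡ (-‿cong (altΣ-*ˡ k xs _)))

  altΣ-+ : ∀ (xs : List A) F G → altΣ xs (λ y ys → F y ys + G y ys) ≈ altΣ xs F + altΣ xs G
  altΣ-+ []       F G = sym (+-identityˡ _)
  altΣ-+ (x ∷ xs) F G = trans (+-congˡ (-‿cong (altΣ-+ xs _ _)))
    (solve 4 (λ a b c d → (a :+ b) :- (c :+ d) := (a :- c) :+ (b :- d)) refl _ _ _ _)

  altΣ-neg : ∀ (xs : List A) F → altΣ xs (λ y ys → - F y ys) ≈ - altΣ xs F
  altΣ-neg []       F = solve 0 (con (+ 0) := :- con (+ 0)) refl
  altΣ-neg (x ∷ xs) F = trans (+-congˡ (-‿cong (altΣ-neg xs _)))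
    (solve 2 (λ a b → :- a :- :- b := :- (a :- b)) refl _ _)

  altΣ-- : ∀ (xs : List A) F G → altΣ xs (λ y ys → F y ys - G y ys) ≈ altΣ xs F - altΣ xs G
  altΣ-- xs F G = trans (altΣ-+ xs F (λ y ys → - G y ys)) (+-congˡ (altΣ-neg xs G))

  altΣ-0 : ∀ (xs : List A) → altΣ xs (λ _ _ → 0#) ≈ 0#
  altΣ-0 xs = trans (altΣ-cong xs (λ _ _ _ → sym (zeroˡ 0#)))
    (trans (sym (altΣ-*ˡ 0# xs (λ _ _ → 0#))) (zeroˡ _))

  altΣ-∑ : ∀ (xs : List A) (zs : List B) (F : B → A → List A → Carrier) →
           ∑ zs (λ z → altΣ xs (F z)) ≈ altΣ xs (λ y ys → ∑ zs (λ z → F z y ys))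
  altΣ-∑ xs []       F = sym (altΣ-0 xs)
  altΣ-∑ xs (z ∷ zs) F = trans (+-congˡ (altΣ-∑ xs zs F)) (sym (altΣ-+ xs _ _))

  altΣ-map : ∀ (h : A → B) xs F → altΣ (map h xs) F ≈ altΣ xs (λ y ys → F (h y) (map h ys))
  altΣ-map h []       F = refl
  altΣ-map h (x ∷ xs) F = +-congˡ (-‿cong (altΣ-map h xs _))

  -- Sum over the arrangements of n entries of S; g also receives the unused entries.
  arr : ℕ → List A → (List A → List A → Carrier) → Carrier
  arr zero    S g = g [] S
  arr (suc n) S g = selΣ S (λ u S′ → arr n S′ (λ us → g (u ∷ us)))

  tup : ℕ → List A → (List A → Carrier) → Carrier
  tup zero    S g = g []
  tup (suc n) S g = ∑ S (λ u → tup n S (λ us → g (u ∷ us)))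

  arr-cong : ∀ n (S : List A) {g h} →
             (∀ us rem → length us ≡ n → us ++ rem ↭ S → g us rem ≈ h us rem) →
             arr n S g ≈ arr n S h
  arr-cong zero    S p = p [] S ≡.refl ↭.refl
  arr-cong (suc n) S p = selΣ-cong S λ u S′ q → arr-cong n S′
    λ us rem l r → p (u ∷ us) rem (≡.cong suc l) (↭-trans (prep u r) q)

  arr-*ˡ : ∀ k n (S : List A) g → k * arr n S g ≈ arr n S (λ us rem → k * g us rem)
  arr-*ˡ k zero    S g = refl
  arr-*ˡ k (suc n) S g = trans (selΣ-*ˡ k S _) (selΣ-cong S λ u S′ _ → arr-*ˡ k n S′ _)

  tup-cong : ∀ n (S : List A) {g h} → (∀ us → length us ≡ n → g us ≈ h us) → tup n S g ≈ tup n S h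
  tup-cong zero    S p = p [] ≡.refl
  tup-cong (suc n) S p = ∑-cong S λ u → tup-cong n S λ us l → p (u ∷ us) (≡.cong suc l)

  tup-0 : ∀ n (S : List A) → tup n S (λ _ → 0#) ≈ 0#
  tup-0 zero    S = refl
  tup-0 (suc n) S = trans (∑-cong S λ _ → tup-0 n S) (∑-0 S)

  tup-*ˡ : ∀ k n (S : List A) g → k * tup n S g ≈ tup n S (λ us → k * g us)
  tup-*ˡ k zero    S g = refl
  tup-*ˡ k (suc n) S g = trans (∑-*ˡ k S _) (∑-cong S λ u → tup-*ˡ k n S _)

  -- `u` occurs exactly once in `S`, so at each position the test kills one choice and leaves the
  -- choices from `S′`.
  tup-avoid : ∀ {k} n {S : List (Fin k)} {u S′} → u ∷ S′ ↭ S → All (u ≢_) S′ → ∀ h →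
              tup n S (λ us → if allᵇ (neqᵇ u) us then h us else 0#) ≈ tup n S′ h
  tup-avoid zero                  p u∉S′ h = refl
  tup-avoid (suc n) {S} {u} {S′} p u∉S′ h = begin
    ∑ S F                          ≈⟨ ∑-↭ F p ⟨
    F u + ∑ S′ F                   ≈⟨ +-cong F-u (∑-cong-All (All.map F-v u∉S′)) ⟩
    0# + tup (suc n) S′ h          ≈⟨ +-identityˡ _ ⟩
    tup (suc n) S′ h               ∎
    where
    F : _ → Carrier
    F v = tup n S (λ us → if neqᵇ u v ∧ allᵇ (neqᵇ u) us then h (v ∷ us) else 0#)

    F-u : F u ≈ 0#
    F-u rewrite neqᵇ-refl u = tup-0 n S

    F-v : ∀ {v} → u ≢ v → F v ≈ tup n S′ (λ us → h (v ∷ us))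
    F-v u≢v rewrite neqᵇ-≢ u≢v = tup-avoid n p u∉S′ _

  -- Without duplicates in `S`, choosing distinct values is the same as removing each value once
  -- chosen. This serves both the filtered list `perms` and the passage from all maps to injections.
  tup-unique : ∀ {k} n {S : List (Fin k)} → Unique S → ∀ g →
               tup n S (λ us → if uniqᵇ us then g us else 0#) ≈ arr n S (λ us _ → g us)
  tup-unique zero    uS g = refl
  tup-unique (suc n) {S} uS g = trans (sym (selΣ-∑ S _)) (selΣ-cong S step)
    where
    step : ∀ u S′ → u ∷ S′ ↭ S →
           tup n S (λ us → if allᵇ (neqᵇ u) us ∧ uniqᵇ us then g (u ∷ us) else 0#)
           ≈ arr n S′ (λ us _ → g (u ∷ us))
    step u S′ p with Unique-resp-↭ (↭-sym p) uS
    ... | u∉S′ ∷ uS′ = begin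
      tup n S (λ us → if allᵇ (neqᵇ u) us ∧ uniqᵇ us then g (u ∷ us) else 0#)
        ≈⟨ tup-cong n S (λ us _ → reflexive (if-∧ (allᵇ (neqᵇ u) us) (uniqᵇ us))) ⟩
      tup n S (λ us → if allᵇ (neqᵇ u) us then (if uniqᵇ us then g (u ∷ us) else 0#) else 0#)
        ≈⟨ tup-avoid n p u∉S′ _ ⟩
      tup n S′ (λ us → if uniqᵇ us then g (u ∷ us) else 0#)
        ≈⟨ tup-unique n uS′ (λ us → g (u ∷ us)) ⟩
      arr n S′ (λ us _ → g (u ∷ us)) ∎

-- Permutations as lists: injectivity and inversions.

allᵇ-cong : ∀ {A : Set} {p q : A → Bool} → (∀ x → p x ≡ q x) → ∀ xs → allᵇ p xs ≡ allᵇ q xs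
allᵇ-cong eq []       = ≡.refl
allᵇ-cong eq (x ∷ xs) = cong₂ _∧_ (eq x) (allᵇ-cong eq xs)

allᵇ-map : ∀ {A B : Set} (p : B → Bool) (f : A → B) xs → allᵇ p (map f xs) ≡ allᵇ (p ∘ f) xs
allᵇ-map p f []       = ≡.refl
allᵇ-map p f (x ∷ xs) = cong (p (f x) ∧_) (allᵇ-map p f xs)

tabulate-allFin : ∀ {A : Set} {n} (f : Fin n → A) → tabulate f ≡ map f (allFin n)
tabulate-allFin f = ≡.sym (List.map-tabulate _ f)

allᵇ-allFin : ∀ {A : Set} {n} (p : A → Bool) (f : Fin n → A) →
              allᵇ (p ∘ f) (allFin n) ≡ allᵇ p (tabulate f)
allᵇ-allFin {n = n} p f = ≡.trans (≡.sym (allᵇ-map p f (allFin n)))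
  (cong (allᵇ p) (≡.sym (tabulate-allFin f)))

allᵇ-suc : ∀ {n} (p : Fin (suc n) → Bool) → allᵇ p (allFin (suc n)) ≡ p zero ∧ allᵇ (p ∘ suc) (allFin n)
allᵇ-suc p = cong (p zero ∧_) (≡.sym (allᵇ-allFin p suc))

separatesᵇ : ∀ {n k} → (Fin n → Fin k) → Fin n → Fin n → Bool
separatesᵇ ω i j = if toℕ i <ᵇ toℕ j then neqᵇ (ω i) (ω j) else true

-- Two independent sizes are needed for the induction: the tail of a map from `Fin n` to itself has
-- a smaller source but the same target.
injᵇ-uniqᵇ : ∀ {n k} (ω : Fin n → Fin k) →
             allᵇ (λ i → allᵇ (separatesᵇ ω i) (allFin n)) (allFin n) ≡ uniqᵇ (tabulate ω)
injᵇ-uniqᵇ {zero}  ω = ≡.refl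
injᵇ-uniqᵇ {suc n} ω = ≡.trans (allᵇ-suc (λ i → allᵇ (separatesᵇ ω i) (allFin (suc n)))) (cong₂ _∧_
  (≡.trans (allᵇ-suc (separatesᵇ ω zero)) (allᵇ-allFin (neqᵇ (ω zero)) (ω ∘ suc)))
  (≡.trans (allᵇ-cong (λ i → allᵇ-suc (separatesᵇ ω (suc i))) (allFin n)) (injᵇ-uniqᵇ (ω ∘ suc))))

belowᵇ : ℕ → ℕ → ℕ
belowᵇ u v = if v <ᵇ u then 1 else 0

#below : ℕ → List ℕ → ℕ
#below u us = sum (map (belowᵇ u) us)

invs : List ℕ → ℕ
invs []       = 0
invs (u ∷ us) = #below u us ℕ.+ invs us

inverted : ∀ {n k} → (Fin n → Fin k) → Fin n → Fin n → ℕ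
inverted ω i j = if (toℕ i <ᵇ toℕ j) ∧ (toℕ (ω j) <ᵇ toℕ (ω i)) then 1 else 0

sum-concatMap : ∀ {A : Set} (f : A → List ℕ) xs → sum (concatMap f xs) ≡ sum (map (sum ∘ f) xs)
sum-concatMap f []       = ≡.refl
sum-concatMap f (x ∷ xs) = ≡.trans (sum-++ (f x) _) (cong (sum (f x) ℕ.+_) (sum-concatMap f xs))

sum-suc : ∀ {n} (f : Fin (suc n) → ℕ) →
          sum (map f (allFin (suc n))) ≡ f zero ℕ.+ sum (map (f ∘ suc) (allFin n))
sum-suc {n} f = cong (λ l → f zero ℕ.+ sum l)
  (≡.trans (cong (map f) (tabulate-allFin suc)) (≡.sym (List.map-∘ (allFin n))))

sum-inverted : ∀ {n k} (ω : Fin n → Fin k) →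
               sum (map (λ i → sum (map (inverted ω i) (allFin n))) (allFin n)) ≡ invs (map toℕ (tabulate ω))
sum-inverted {zero}  ω = ≡.refl
sum-inverted {suc n} ω = ≡.trans (sum-suc (λ i → sum (map (inverted ω i) (allFin (suc n))))) (cong₂ ℕ._+_
  (≡.trans (sum-suc (inverted ω zero)) (cong sum (≡.trans
    (List.map-∘ {g = belowᵇ (toℕ (ω zero))} {f = λ j → toℕ (ω (suc j))} (allFin n))
    (cong (map (belowᵇ (toℕ (ω zero)))) (≡.trans
      (List.map-∘ {g = toℕ} {f = ω ∘ suc} (allFin n))
      (cong (map toℕ) (≡.sym (tabulate-allFin (ω ∘ suc)))))))))
  (≡.trans (cong sum (List.map-cong (λ i → sum-suc (inverted ω (suc i))) (allFin n)))
    (sum-inverted (ω ∘ suc))))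

inversions-invs : ∀ {n} (ω : Fin n → Fin n) → inversions ω ≡ invs (map toℕ (tabulate ω))
inversions-invs {n} ω = ≡.trans (sum-concatMap (λ i → map (inverted ω i) (allFin n)) (allFin n)) (sum-inverted ω)

++-full : ∀ {A : Set} {us rem S : List A} → us ++ rem ↭ S → length us ≡ length S → us ↭ S
++-full {us = us} {[]}      p l = ≡.subst (_↭ _) (List.++-identityʳ us) p
++-full {us = us} {r ∷ rem} p l = ⊥-elim (ℕ.m≢1+m+n (length us) (≡.trans l (≡.trans (≡.sym (↭-length p))
  (≡.trans (List.length-++ us) (ℕ.+-suc (length us) (length rem))))))

-- Unlike `2 ℕ.* h`, this exposes two constructors at `suc h`, so a list of length `dbl (suc h)`
-- splits into a pair and a rest by pattern matching.
dbl : ℕ → ℕ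
dbl zero    = zero
dbl (suc h) = suc (suc (dbl h))

2*≡dbl : ∀ h → 2 ℕ.* h ≡ dbl h
2*≡dbl zero    = ≡.refl
2*≡dbl (suc h) = ≡.trans (cong suc (ℕ.+-suc h _)) (cong (λ k → suc (suc k)) (2*≡dbl h))

-- The ordering condition on the pairs of a Pfaffian term.

ix : ℕ → List ℕ
ix h = map toℕ (allFin h)

ix-suc : ∀ h → ix (suc h) ≡ 0 ∷ map suc (ix h)
ix-suc h = cong (0 ∷_) (≡.trans (cong (map toℕ) (tabulate-allFin suc))
  (≡.trans (≡.sym (List.map-∘ (allFin h))) (List.map-∘ (allFin h))))

allᵇ-ix : ∀ h p → allᵇ p (ix (suc h)) ≡ p 0 ∧ allᵇ (p ∘ suc) (ix h)
allᵇ-ix h p = ≡.trans (cong (allᵇ p) (ix-suc h)) (cong (p 0 ∧_) (allᵇ-map p suc (ix h)))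

nth-even : ∀ a b us i → nth (a ∷ b ∷ us) (2 ℕ.* suc i) ≡ nth us (2 ℕ.* i)
nth-even a b us i = cong (nth (b ∷ us)) (ℕ.+-suc i _)

nth-odd : ∀ a b us i → nth (a ∷ b ∷ us) (suc (2 ℕ.* suc i)) ≡ nth us (suc (2 ℕ.* i))
nth-odd a b us i = cong (nth us) (ℕ.+-suc i _)

pairsᵇ startsᵇ condᵇ : ℕ → List ℕ → Bool
pairsᵇ h us = allᵇ (λ i → nth us (2 ℕ.* i) <ᵇ nth us (suc (2 ℕ.* i))) (ix h)
startsᵇ h us = allᵇ (λ i → if suc i <ᵇ h then nth us (2 ℕ.* i) <ᵇ nth us (2 ℕ.* suc i) else true) (ix h)
condᵇ h us = pairsᵇ h us ∧ startsᵇ h us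

precedesᵇ : ℕ → ℕ → List ℕ → Bool
precedesᵇ a h us = if 0 <ᵇ h then a <ᵇ nth us 0 else true

pairsᵇ-suc : ∀ h a b us → pairsᵇ (suc h) (a ∷ b ∷ us) ≡ (a <ᵇ b) ∧ pairsᵇ h us
pairsᵇ-suc h a b us = ≡.trans (allᵇ-ix h _) (cong ((a <ᵇ b) ∧_)
  (allᵇ-cong (λ i → cong₂ _<ᵇ_ (nth-even a b us i) (nth-odd a b us i)) (ix h)))

startsᵇ-suc : ∀ h a b us → startsᵇ (suc h) (a ∷ b ∷ us) ≡ precedesᵇ a h us ∧ startsᵇ h us
startsᵇ-suc h a b us = ≡.trans (allᵇ-ix h _) (cong (precedesᵇ a h us ∧_)
  (allᵇ-cong (λ i → cong (λ c → if suc i <ᵇ h then c else true)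
    (cong₂ _<ᵇ_ (nth-even a b us i) (nth-even a b us (suc i)))) (ix h)))

condᵇ-suc : ∀ h a b us → condᵇ (suc h) (a ∷ b ∷ us) ≡
            ((a <ᵇ b) ∧ precedesᵇ a h us) ∧ condᵇ h us
condᵇ-suc h a b us = ≡.trans (cong₂ _∧_ (pairsᵇ-suc h a b us) (startsᵇ-suc h a b us))
  (rearrange (a <ᵇ b) (pairsᵇ h us) (precedesᵇ a h us) (startsᵇ h us))
  where
  rearrange : ∀ p q r s → (p ∧ q) ∧ (r ∧ s) ≡ (p ∧ r) ∧ (q ∧ s)
  rearrange false q     r     s = ≡.refl
  rearrange true  true  true  s = ≡.refl
  rearrange true  true  false s = ≡.refl
  rearrange true  false true  s = ≡.refl
  rearrange true  false false s = ≡.refl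

<ᵇ-true : ∀ {a b} → a < b → (a <ᵇ b) ≡ true
<ᵇ-true {a} {b} p with a <ᵇ b | ℕ.<⇒<ᵇ p
... | true | _ = ≡.refl

<ᵇ-false : ∀ {a b} → b ≤ a → (a <ᵇ b) ≡ false
<ᵇ-false {a} {b} p with a <ᵇ b | ℕ.<ᵇ⇒< a b
... | true  | f = ⊥-elim (ℕ.<⇒≱ (f _) p)
... | false | _ = ≡.refl

∧-split : ∀ {b b′} → b ∧ b′ ≡ true → b ≡ true × b′ ≡ true
∧-split {true} p = ≡.refl , p

≡true⇒< : ∀ {a b} → (a <ᵇ b) ≡ true → a < b
≡true⇒< {a} {b} p = ℕ.<ᵇ⇒< a b (≡.subst Bool.T (≡.sym p) _)

-- The first members of the pairs increase and each is below its partner, so the very first entry is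
-- the least. Hence only arrangements that start with the least index survive in the Pfaffian.
condᵇ-min : ∀ h us → length us ≡ dbl h → condᵇ h us ≡ true → All (nth us 0 ≤_) us
condᵇ-min zero    []           l p = []
condᵇ-min (suc h) (a ∷ b ∷ us) l p
  with ∧-split {(a <ᵇ b) ∧ precedesᵇ a h us} (≡.trans (≡.sym (condᵇ-suc h a b us)) p)
... | q , c with ∧-split {a <ᵇ b} q
... | a<b , r = ℕ.≤-refl ∷ ℕ.<⇒≤ (≡true⇒< a<b) ∷ tail h us l′ r (condᵇ-min h us l′ c)
  where
  l′ = ℕ.suc-injective (ℕ.suc-injective l)
  tail : ∀ h us → length us ≡ dbl h → precedesᵇ a h us ≡ true → All (nth us 0 ≤_) us → All (a ≤_) us
  tail zero    []       l r m = []
  tail (suc h) (_ ∷ us) l r m = All.map (ℕ.≤-trans (ℕ.<⇒≤ (≡true⇒< r))) m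

condᵇ-notmin : ∀ h a us s → length (a ∷ us) ≡ dbl h → s ∈ us → s < a → condᵇ h (a ∷ us) ≡ false
condᵇ-notmin h a us s l s∈us s<a with condᵇ h (a ∷ us) in eq
... | false = ≡.refl
... | true  = ⊥-elim (ℕ.<⇒≱ s<a (All.lookup (condᵇ-min h (a ∷ us) l eq) (there s∈us)))

precedesᵇ-least : ∀ a h us → length us ≡ dbl h → All (a <_) us → precedesᵇ a h us ≡ true
precedesᵇ-least a zero    us       l m       = ≡.refl
precedesᵇ-least a (suc h) (_ ∷ us) l (p ∷ _) = <ᵇ-true p

condᵇ-head : ∀ h a b us → length us ≡ dbl h → a < b → All (a <_) us →
             condᵇ (suc h) (a ∷ b ∷ us) ≡ condᵇ h us
condᵇ-head h a b us l a<b a<us rewrite condᵇ-suc h a b us | <ᵇ-true a<b | precedesᵇ-least a h us l a<us = ≡.refl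

#below-none : ∀ {u us} → All (u ≤_) us → #below u us ≡ 0
#below-none []      = ≡.refl
#below-none (p ∷ m) rewrite <ᵇ-false p = #below-none m

#below-↭ : ∀ u {us vs} → us ↭ vs → #below u us ≡ #below u vs
#below-↭ u p = sum-↭ (map⁺ (belowᵇ u) p)

-- The permutation sum of the Pfaffian equals its expansion along the first row.

module Pfaffian {c ℓ : Level} (R : CommutativeRing c ℓ) where
  open CommutativeRing R hiding (zero)
  open Sums R public
  open import Relation.Binary.Reasoning.Setoid setoid
  private variable A I : Set

  ∑-allFuns : ∀ n k (g : List (Fin k) → Carrier) →
              ∑ (allFuns n k) (g ∘ tabulate) ≈ tup n (allFin k) g
  ∑-allFuns zero    k g = +-identityʳ _
  ∑-allFuns (suc n) k g = begin
    ∑ (concatMap (λ f → map (λ u → u VF.∷ f) (allFin k)) (allFuns n k)) (g ∘ tabulate)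
      ≈⟨ ∑-concatMap _ (allFuns n k) _ ⟩
    ∑ (allFuns n k) (λ f → ∑ (map (λ u → u VF.∷ f) (allFin k)) (g ∘ tabulate))
      ≈⟨ ∑-cong (allFuns n k) (λ f → ∑-map _ (allFin k) _) ⟩
    ∑ (allFuns n k) (λ f → ∑ (allFin k) (λ u → g (u ∷ tabulate f)))
      -- `allFuns` varies the first value fastest, while `tup` sums over it outermost.
      ≈⟨ ∑-swap (allFuns n k) (allFin k) _ ⟩
    ∑ (allFin k) (λ u → ∑ (allFuns n k) (λ f → g (u ∷ tabulate f)))
      ≈⟨ ∑-cong (allFin k) (λ u → ∑-allFuns n k (λ us → g (u ∷ us))) ⟩
    tup (suc n) (allFin k) g ∎

  ∑-perms : ∀ n (g : List (Fin n) → Carrier) →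
            ∑ (perms n) (g ∘ tabulate) ≈ arr n (allFin n) (λ us _ → g us)
  ∑-perms n g = begin
    ∑ (perms n) (g ∘ tabulate)
      ≈⟨ ∑-filter isInjᵇ (allFuns n n) _ ⟩
    ∑ (allFuns n n) (λ ω → if isInjᵇ ω then g (tabulate ω) else 0#)
      ≈⟨ ∑-cong (allFuns n n) (λ ω → reflexive (cong (λ b → if b then g (tabulate ω) else 0#) (injᵇ-uniqᵇ ω))) ⟩
    ∑ (allFuns n n) (λ ω → if uniqᵇ (tabulate ω) then g (tabulate ω) else 0#)
      ≈⟨ ∑-allFuns n n (λ us → if uniqᵇ us then g us else 0#) ⟩
    tup n (allFin n) (λ us → if uniqᵇ us then g us else 0#)
      ≈⟨ tup-unique n (Unique.allFin⁺ n) g ⟩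
    arr n (allFin n) (λ us _ → g us) ∎

  selΣ-map : ∀ {A B : Set} (h : A → B) xs F → selΣ (map h xs) F ≈ selΣ xs (λ y ys → F (h y) (map h ys))
  selΣ-map h []       F = refl
  selΣ-map h (x ∷ xs) F = +-congˡ (selΣ-map h xs _)

  arr-map : ∀ {A B : Set} (h : A → B) n S g →
            arr n (map h S) g ≈ arr n S (λ us rem → g (map h us) (map h rem))
  arr-map h zero    S g = refl
  arr-map h (suc n) S g = trans (selΣ-map h S _) (selΣ-cong S λ u S′ _ → arr-map h n S′ _)

  arr-0 : ∀ n (S : List A) → arr n S (λ _ _ → 0#) ≈ 0#
  arr-0 n S = trans (arr-cong n S (λ _ _ _ _ → sym (zeroˡ 0#)))
    (trans (sym (arr-*ˡ 0# n S (λ _ _ → 0#))) (zeroˡ _))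

  selΣ-0 : ∀ (S : List A) → selΣ S (λ _ _ → 0#) ≈ 0#
  selΣ-0 S = trans (selΣ-∑ S _) (∑-0 S)

  -- The Pfaffian by expansion along the first row, on an index list of length 2h.
  pf : (I → I → Carrier) → ℕ → List I → Carrier
  pf B zero    []       = 1#
  pf B zero    (_ ∷ _)  = 0#
  pf B (suc h) []       = 0#
  pf B (suc h) (u ∷ us) = altΣ us (λ v rest → B u v * pf B h rest)

  signPow-+ : ∀ m n → signPow R (m ℕ.+ n) ≈ signPow R m * signPow R n
  signPow-+ zero    n = sym (*-identityˡ _)
  signPow-+ (suc m) n = trans (-‿cong (signPow-+ m n))
    (solve 2 (λ a b → :- (a :* b) := (:- a) :* b) refl _ _)

  Sorted : List ℕ → Set
  Sorted = AllPairs _<_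

  -- In a sorted list the number of entries below `b` is the position of `b`, so the inversion sign
  -- is the sign that `altΣ` builds in. In the induction each entry passed adds one to `#below`,
  -- which replacing `G` by its negative absorbs.
  selΣ-sorted : ∀ {S} → Sorted S → ∀ F G →
    (∀ b S′ → Sorted S′ → b ∷ S′ ↭ S → F b S′ ≈ signPow R (#below b S′) * G b S′) →
    selΣ S F ≈ altΣ S G
  selΣ-sorted []                            F G hyp = refl
  selΣ-sorted {x ∷ xs} (x<xs ∷ sxs) F G hyp = +-cong
    (trans (hyp x xs sxs ↭.refl)
      (trans (*-congʳ (reflexive (cong (signPow R) (#below-none (All.map ℕ.<⇒≤ x<xs))))) (*-identityˡ _)))
    (trans (selΣ-sorted sxs _ (λ y ys → - G y (x ∷ ys)) step) (altΣ-neg xs _))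
    where
    step : ∀ b S′ → Sorted S′ → b ∷ S′ ↭ xs →
           F b (x ∷ S′) ≈ signPow R (#below b S′) * (- G b (x ∷ S′))
    step b S′ sS′ p with All-resp-↭ (↭-sym p) x<xs
    ... | x<b ∷ x<S′ = trans
      (hyp b (x ∷ S′) (x<S′ ∷ sS′) (↭-trans (swap b x ↭.refl) (prep x p)))
      (trans (*-congʳ (reflexive (cong (λ t → signPow R ((if t then 1 else 0) ℕ.+ #below b S′)) (<ᵇ-true x<b))))
        (solve 2 (λ s g → :- s :* g := s :* :- g) refl _ _))

  module _ (A : ℕ → ℕ → Carrier) where

    pairing : ℕ → List ℕ → Carrier
    pairing h us = ∏ (ix h) (λ i → A (nth us (2 ℕ.* i)) (nth us (suc (2 ℕ.* i))))

    pfTerm : ℕ → List ℕ → Carrier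
    pfTerm h us = if condᵇ h us then signPow R (invs us) * pairing h us else 0#

    pairing-suc : ∀ h a b us → pairing (suc h) (a ∷ b ∷ us) ≈ A a b * pairing h us
    pairing-suc h a b us = trans (reflexive (cong (λ is → ∏ is entry) (ix-suc h)))
      (*-congˡ (trans (∏-map suc (ix h) entry)
        (∏-cong (ix h) (λ i → reflexive (cong₂ A (nth-even a b us i) (nth-odd a b us i))))))
      where
      entry : ℕ → Carrier
      entry i = A (nth (a ∷ b ∷ us) (2 ℕ.* i)) (nth (a ∷ b ∷ us) (suc (2 ℕ.* i)))

    pfTerm-suc : ∀ h a b us S → length us ≡ dbl h → a < b → All (a <_) us → us ↭ S →
      pfTerm (suc h) (a ∷ b ∷ us) ≈ signPow R (#below b S) * A a b * pfTerm h us
    pfTerm-suc h a b us S l a<b a<us p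
      rewrite condᵇ-head h a b us l a<b a<us | #below-none (ℕ.<⇒≤ a<b ∷ All.map ℕ.<⇒≤ a<us) | #below-↭ b p
      with condᵇ h us
    ... | false = sym (zeroʳ _)
    ... | true  = trans (*-cong (signPow-+ (#below b S) (invs us)) (pairing-suc h a b us))
      (solve 4 (λ s t a p → (s :* t) :* (a :* p) := (s :* a) :* (t :* p)) refl _ _ _ _)

    -- The ordering condition forces the first entry to be the least index `a`, which creates no
    -- inversion. Its partner `b` creates `#below b S′` inversions whatever the order of the rest,
    -- and these turn the choice of `b` into the signed expansion along the row of `a`.
    arr-pfTerm : ∀ h {S} → Sorted S → length S ≡ dbl h →
                 arr (dbl h) S (λ us _ → pfTerm h us) ≈ pf A h S
    arr-pfTerm zero    {[]}     sS l = *-identityˡ _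
    arr-pfTerm (suc h) {a ∷ S} (a<S ∷ sS) l = begin
      arr (suc (dbl h)) S (λ us _ → pfTerm (suc h) (a ∷ us)) +
        selΣ S (λ y ys → arr (suc (dbl h)) (a ∷ ys) (λ us _ → pfTerm (suc h) (y ∷ us)))
        ≈⟨ +-congˡ (trans (selΣ-cong S others) (selΣ-0 S)) ⟩
      arr (suc (dbl h)) S (λ us _ → pfTerm (suc h) (a ∷ us)) + 0#
        ≈⟨ +-identityʳ _ ⟩
      selΣ S (λ b S′ → arr (dbl h) S′ (λ us _ → pfTerm (suc h) (a ∷ b ∷ us)))
        ≈⟨ selΣ-sorted sS _ _ step ⟩
      pf A (suc h) (a ∷ S) ∎
      where
      others : ∀ y ys → y ∷ ys ↭ S →
               arr (suc (dbl h)) (a ∷ ys) (λ us _ → pfTerm (suc h) (y ∷ us)) ≈ 0#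
      others y ys p = trans (arr-cong (suc (dbl h)) (a ∷ ys) vanish) (arr-0 (suc (dbl h)) (a ∷ ys))
        where
        vanish : ∀ us rem → length us ≡ suc (dbl h) → us ++ rem ↭ a ∷ ys →
                 pfTerm (suc h) (y ∷ us) ≈ 0#
        vanish us rem lu q with All-resp-↭ (↭-sym p) a<S
        ... | a<y ∷ _ rewrite condᵇ-notmin (suc h) y us a (cong suc lu)
                (∈-resp-↭ (↭-sym (++-full q (≡.trans lu (≡.sym (≡.trans (↭-length p) (ℕ.suc-injective l)))))) (here ≡.refl)) a<y = refl

      step : ∀ b S′ → Sorted S′ → b ∷ S′ ↭ S →
             arr (dbl h) S′ (λ us _ → pfTerm (suc h) (a ∷ b ∷ us)) ≈ signPow R (#below b S′) * (A a b * pf A h S′)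
      step b S′ sS′ p with All-resp-↭ (↭-sym p) a<S
      ... | a<b ∷ a<S′ = begin
        arr (dbl h) S′ (λ us _ → pfTerm (suc h) (a ∷ b ∷ us))
          ≈⟨ arr-cong (dbl h) S′ expand ⟩
        arr (dbl h) S′ (λ us _ → signPow R (#below b S′) * A a b * pfTerm h us)
          ≈⟨ arr-*ˡ _ (dbl h) S′ _ ⟨
        signPow R (#below b S′) * A a b * arr (dbl h) S′ (λ us _ → pfTerm h us)
          ≈⟨ *-congˡ (arr-pfTerm h sS′ lS′) ⟩
        signPow R (#below b S′) * A a b * pf A h S′
          ≈⟨ *-assoc _ _ _ ⟩
        signPow R (#below b S′) * (A a b * pf A h S′) ∎
        where
        lS′ : length S′ ≡ dbl h
        lS′ = ℕ.suc-injective (≡.trans (↭-length p) (ℕ.suc-injective l))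
        expand : ∀ us rem → length us ≡ dbl h → us ++ rem ↭ S′ →
                 pfTerm (suc h) (a ∷ b ∷ us) ≈ signPow R (#below b S′) * A a b * pfTerm h us
        expand us rem lu q = pfTerm-suc h a b us S′ lu a<b (All-resp-↭ (↭-sym us↭S′) a<S′) us↭S′
          where us↭S′ = ++-full q (≡.trans lu (≡.sym lS′))

    Pf-pf : ∀ h → Pf R h A ≈ pf A h (ix (2 ℕ.* h))
    Pf-pf h = begin
      Pf R h A
        ≈⟨ ∑-filter (pfCondᵇ h) (perms n) _ ⟩
      ∑ (perms n) (λ ω → if pfCondᵇ h ω then signPow R (inversions ω) * pairing h (values ω) else 0#)
        ≈⟨ ∑-cong (perms n) (λ ω → reflexive (≡.trans
             (cong (λ k → if condᵇ h (values ω) then signPow R k * pairing h (values ω) else 0#) (inversions-invs ω))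
             (cong (λ vs → if condᵇ h vs then signPow R (invs (map toℕ (tabulate ω))) * pairing h vs else 0#) (values≡ ω)))) ⟩
      ∑ (perms n) (λ ω → pfTerm h (map toℕ (tabulate ω)))
        ≈⟨ ∑-perms n (λ us → pfTerm h (map toℕ us)) ⟩
      arr n (allFin n) (λ us _ → pfTerm h (map toℕ us))
        ≈⟨ arr-map toℕ n (allFin n) _ ⟨
      arr n (ix n) (λ us _ → pfTerm h us)
        ≡⟨ cong (λ k → arr k (ix n) (λ us _ → pfTerm h us)) (2*≡dbl h) ⟩
      arr (dbl h) (ix n) (λ us _ → pfTerm h us)
        ≈⟨ arr-pfTerm h (sorted n) (≡.trans (List.length-map toℕ (allFin n)) (≡.trans (List.length-tabulate _) (2*≡dbl h))) ⟩
      pf A h (ix n) ∎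
      where
      n = 2 ℕ.* h
      values : (Fin n → Fin n) → List ℕ
      values ω = map (λ i → toℕ (ω i)) (allFin n)
      values≡ : ∀ ω → values ω ≡ map toℕ (tabulate ω)
      values≡ ω = ≡.trans (List.map-∘ (allFin n)) (cong (map toℕ) (≡.sym (tabulate-allFin ω)))
      sorted-suc : ∀ {S} → Sorted S → Sorted (map suc S)
      sorted-suc []      = []
      sorted-suc (p ∷ s) = below p ∷ sorted-suc s
        where
        below : ∀ {x xs} → All (x <_) xs → All (suc x <_) (map suc xs)
        below []       = []
        below (p ∷ ps) = s≤s p ∷ below ps
      positive : ∀ S → All (0 <_) (map suc S)
      positive []      = []
      positive (x ∷ S) = s≤s z≤n ∷ positive S
      sorted : ∀ n → Sorted (ix n)
      sorted zero    = []
      sorted (suc n) rewrite ix-suc n = positive (ix n) ∷ sorted-suc (sorted n)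

-- The Pfaffian as an alternating function of its index list.

module _ {A : Set} where

  data Swap : List A → List A → Set where
    here  : ∀ {u v us} → Swap (u ∷ v ∷ us) (v ∷ u ∷ us)
    there : ∀ {w us vs} → Swap us vs → Swap (w ∷ us) (w ∷ vs)

  data Repeats : List A → Set where
    here  : ∀ {u us} → u ∈ us → Repeats (u ∷ us)
    there : ∀ {u us} → Repeats us → Repeats (u ∷ us)

  bubble : ∀ {u us} → u ∈ us → ∃ λ vs → Star Swap (u ∷ us) (u ∷ u ∷ vs)
  bubble {us = _ ∷ us} (here ≡.refl) = us , ε
  bubble {us = v ∷ us} (there u∈us) with bubble u∈us
  ... | vs , s = v ∷ vs , here ◅ gmap (v ∷_) there s ◅◅ here ◅ there here ◅ ε

  Repeats-front : ∀ {us} → Repeats us → ∃ λ u → ∃ λ vs → Star Swap us (u ∷ u ∷ vs)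
  Repeats-front (here {u} u∈us) with bubble u∈us
  ... | vs , s = u , vs , s
  Repeats-front (there {w} r) with Repeats-front r
  ... | u , vs , s = u , w ∷ vs , gmap (w ∷_) there s ◅◅ here ◅ there here ◅ ε

module PfaffianTheory {c ℓ : Level} (R : CommutativeRing c ℓ) where
  open CommutativeRing R hiding (zero)
  open Pfaffian R public
  open import Relation.Binary.Reasoning.Setoid setoid
  private variable I K : Set

  -- If the selected entry is one of the two exchanged, its position changes parity; otherwise the
  -- exchange happens in the remaining list and `F` supplies the sign.
  altΣ-swap : ∀ {us vs : List I} → Swap us vs → ∀ F →
              (∀ y {r r′} → Swap r r′ → F y r ≈ - F y r′) → altΣ us F ≈ - altΣ vs F
  altΣ-swap (here {u} {v} {us}) F anti = trans
    (+-congˡ (-‿cong (+-congˡ (-‿cong (trans (altΣ-cong us (λ y r _ → anti y here)) (altΣ-neg us _))))))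
    (solve 3 (λ a b x → a :- (b :- :- x) := :- (b :- (a :- x))) refl _ _ _)
  altΣ-swap (there {w} s) F anti = trans
    (+-cong (anti w s) (-‿cong (altΣ-swap s _ (λ y t → anti y (there t)))))
    (solve 2 (λ a x → :- a :- :- x := :- (a :- x)) refl _ _)

  -- Of the two orders in which a pair of entries can be removed, exactly one shifts the position of
  -- the second by one, so the two orders carry opposite signs.
  altΣ²-anti : ∀ (us : List I) (G : I → I → List I → Carrier) →
    altΣ us (λ v r → altΣ r (G v)) ≈ - altΣ us (λ v r → altΣ r (λ w → G w v))
  altΣ²-anti []       G = solve 0 (con (+ 0) := :- con (+ 0)) refl
  altΣ²-anti (x ∷ us) G = begin
    altΣ us (G x) - altΣ us (λ v r → G v x r - altΣ r (λ w s → G v w (x ∷ s)))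
      ≈⟨ +-congˡ (-‿cong (altΣ-- us _ _)) ⟩
    altΣ us (G x) - (altΣ us (λ v → G v x) - altΣ us (λ v r → altΣ r (λ w s → G v w (x ∷ s))))
      ≈⟨ +-congˡ (-‿cong (+-congˡ (-‿cong (altΣ²-anti us (λ v w s → G v w (x ∷ s)))))) ⟩
    altΣ us (G x) - (altΣ us (λ v → G v x) - - altΣ us (λ v r → altΣ r (λ w s → G w v (x ∷ s))))
      ≈⟨ solve 3 (λ a b x → a :- (b :- :- x) := :- (b :- (a :- x))) refl _ _ _ ⟩
    - (altΣ us (λ v → G v x) - (altΣ us (G x) - altΣ us (λ v r → altΣ r (λ w s → G w v (x ∷ s)))))
      ≈⟨ -‿cong (+-congˡ (-‿cong (altΣ-- us _ _))) ⟨
    - (altΣ us (λ v → G v x) - altΣ us (λ v r → G x v r - altΣ r (λ w s → G w v (x ∷ s)))) ∎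

  module _ (B : I → I → Carrier) (B-skew : ∀ u v → B u v ≈ - B v u) where

    -- These are the terms of the expansion in which the two leading indices are not paired with
    -- each other. Expanding once more along the other index gives a sum over ordered double
    -- selections, to which `altΣ²-anti` applies.
    pf-cross : ∀ h u v us →
      altΣ us (λ w r → B u w * pf B h (v ∷ r)) ≈ - altΣ us (λ w r → B v w * pf B h (u ∷ r))
    pf-cross zero    u v us = begin
      altΣ us (λ w r → B u w * 0#)        ≈⟨ vanish u ⟩
      0#                                   ≈⟨ solve 0 (con (+ 0) := :- con (+ 0)) refl ⟩
      - 0#                                 ≈⟨ -‿cong (vanish v) ⟨
      - altΣ us (λ w r → B v w * 0#)      ∎
      where
      vanish : ∀ u → altΣ us (λ w r → B u w * 0#) ≈ 0#
      vanish u = trans (altΣ-cong us (λ _ _ _ → zeroʳ _)) (altΣ-0 us)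
    pf-cross (suc h) u v us = begin
      altΣ us (λ w r → B u w * altΣ r (λ z s → B v z * pf B h s))
        ≈⟨ altΣ-cong us (λ w r _ → altΣ-*ˡ (B u w) r _) ⟩
      altΣ us (λ w r → altΣ r (λ z s → B u w * (B v z * pf B h s)))
        ≈⟨ altΣ²-anti us (λ w z s → B u w * (B v z * pf B h s)) ⟩
      - altΣ us (λ w r → altΣ r (λ z s → B u z * (B v w * pf B h s)))
        ≈⟨ -‿cong (altΣ-cong us (λ w r _ → trans
             (altΣ-cong r (λ z s _ → solve 3 (λ a b p → a :* (b :* p) := b :* (a :* p)) refl _ _ _))
             (sym (altΣ-*ˡ (B v w) r _)))) ⟩
      - altΣ us (λ w r → B v w * altΣ r (λ z s → B u z * pf B h s)) ∎

    pf-swap : ∀ h {us vs} → Swap us vs → pf B h us ≈ - pf B h vs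
    pf-swap zero    here      = solve 0 (con (+ 0) := :- con (+ 0)) refl
    pf-swap zero    (there s) = solve 0 (con (+ 0) := :- con (+ 0)) refl
    pf-swap (suc h) (here {u} {v} {us}) = trans
      (+-cong (*-congʳ (B-skew u v)) (-‿cong (pf-cross h u v us)))
      (solve 3 (λ b p x → (:- b) :* p :- :- x := :- (b :* p :- x)) refl _ _ _)
    pf-swap (suc h) (there {w} s) = altΣ-swap s _
      (λ y t → trans (*-congˡ (pf-swap h t)) (solve 2 (λ b p → b :* :- p := :- (b :* p)) refl _ _))

    -- Adjacent exchanges bring two equal indices to the front; the signs picked up do not affect
    -- vanishing. Exchanging the equal pair then shows that the Pfaffian is its own negative.
    pf-repeats : (∀ y → y + y ≈ 0# → y ≈ 0#) → ∀ h {us} → Repeats us → pf B h us ≈ 0#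
    pf-repeats halve h rep with Repeats-front rep
    ... | u , vs , s = along s (halve _ (trans (+-congˡ (pf-swap h here)) (-‿inverseʳ _)))
      where
      along : ∀ {us vs} → Star Swap us vs → pf B h vs ≈ 0# → pf B h us ≈ 0#
      along ε       p = p
      along (t ◅ s) p = trans (pf-swap h t) (trans (-‿cong (along s p)) (solve 0 (:- con (+ 0) := con (+ 0)) refl))

  -- `altΣ-cong` knows the remaining list only up to permutation and so forgets its order. Here a
  -- relation between earlier and later entries is handed on to the remainder.
  altΣ-cong-AllPairs : ∀ {P : K → K → Set ℓ} {xs} → AllPairs P xs → ∀ {F G} →
    (∀ y ys → y ∷ ys ↭ xs → AllPairs P ys → F y ys ≈ G y ys) → altΣ xs F ≈ altΣ xs G
  altΣ-cong-AllPairs []                     hyp = refl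
  altΣ-cong-AllPairs {xs = x ∷ xs} (p ∷ ps) hyp = +-cong (hyp x xs ↭.refl ps)
    (-‿cong (altΣ-cong-AllPairs ps λ y ys q qs →
      hyp y (x ∷ ys) (↭-trans (swap y x ↭.refl) (prep x q)) (All.tail (All-resp-↭ (↭-sym q) p) ∷ qs)))

  -- Multilinear expansion of a Pfaffian.

  module Multilinear (D : K → List I) (w : K → I → Carrier) where

    choices : List K → (List I → Carrier) → Carrier
    choices []       g = g []
    choices (k ∷ ks) g = ∑ (D k) (λ u → w k u * choices ks (λ us → g (u ∷ us)))

    choices-*ˡ : ∀ a ks g → a * choices ks g ≈ choices ks (λ us → a * g us)
    choices-*ˡ a []       g = refl
    choices-*ˡ a (k ∷ ks) g = trans (∑-*ˡ a (D k) _) (∑-cong (D k) λ u → trans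
      (solve 3 (λ a w x → a :* (w :* x) := w :* (a :* x)) refl _ _ _)
      (*-congˡ (choices-*ˡ a ks _)))

    choices-- : ∀ ks g h → choices ks (λ us → g us - h us) ≈ choices ks g - choices ks h
    choices-- []       g h = refl
    choices-- (k ∷ ks) g h = begin
      ∑ (D k) (λ u → w k u * choices ks (λ us → g (u ∷ us) - h (u ∷ us)))
        ≈⟨ ∑-cong (D k) (λ u → trans (*-congˡ (choices-- ks _ _))
             (solve 3 (λ w a b → w :* (a :- b) := w :* a :+ :- (w :* b)) refl _ _ _)) ⟩
      ∑ (D k) (λ u → w k u * choices ks (λ us → g (u ∷ us)) + - (w k u * choices ks (λ us → h (u ∷ us))))
        ≈⟨ trans (∑-+ (D k) _ _) (+-congˡ (∑-neg (D k) _)) ⟩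
      choices (k ∷ ks) g - choices (k ∷ ks) h ∎

    -- The selected entry is the choice made for some row `l`, so `l` may be selected first and its
    -- choice summed outermost; the choices of different rows are independent.
    choices-altΣ : ∀ ks F → choices ks (λ us → altΣ us F) ≈
                   altΣ ks (λ l ls → ∑ (D l) (λ v → w l v * choices ls (F v)))
    choices-altΣ []       F = refl
    choices-altΣ (k ∷ ks) F = begin
      ∑ (D k) (λ u → w k u * choices ks (λ us → F u us - altΣ us (λ v r → F v (u ∷ r))))
        ≈⟨ ∑-cong (D k) (λ u → trans (*-congˡ (trans (choices-- ks _ _) (+-congˡ (-‿cong (choices-altΣ ks _)))))
             (solve 3 (λ w a b → w :* (a :- b) := w :* a :+ :- (w :* b)) refl _ _ _)) ⟩
      ∑ (D k) (λ u → w k u * choices ks (F u) + - (w k u * altΣ ks (λ l ls → ∑ (D l) (λ v → w l v * choices ls (λ r → F v (u ∷ r))))))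
        ≈⟨ trans (∑-+ (D k) _ _) (+-congˡ (∑-neg (D k) _)) ⟩
      ∑ (D k) (λ u → w k u * choices ks (F u)) - ∑ (D k) (λ u → w k u * altΣ ks (λ l ls → ∑ (D l) (λ v → w l v * choices ls (λ r → F v (u ∷ r)))))
        ≈⟨ +-congˡ (-‿cong (trans
             (∑-cong (D k) (λ u → altΣ-*ˡ (w k u) ks _))
             (trans (altΣ-∑ ks (D k) _) (altΣ-cong ks (λ l ls _ → exchange l ls))))) ⟩
      altΣ (k ∷ ks) (λ l ls → ∑ (D l) (λ v → w l v * choices ls (F v))) ∎
      where
      exchange : ∀ l ls →
        ∑ (D k) (λ u → w k u * ∑ (D l) (λ v → w l v * choices ls (λ r → F v (u ∷ r)))) ≈
        ∑ (D l) (λ v → w l v * ∑ (D k) (λ u → w k u * choices ls (λ r → F v (u ∷ r))))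
      exchange l ls = begin
        ∑ (D k) (λ u → w k u * ∑ (D l) (λ v → w l v * choices ls (λ r → F v (u ∷ r))))
          ≈⟨ ∑-cong (D k) (λ u → ∑-*ˡ (w k u) (D l) _) ⟩
        ∑ (D k) (λ u → ∑ (D l) (λ v → w k u * (w l v * choices ls (λ r → F v (u ∷ r)))))
          ≈⟨ ∑-swap (D k) (D l) _ ⟩
        ∑ (D l) (λ v → ∑ (D k) (λ u → w k u * (w l v * choices ls (λ r → F v (u ∷ r)))))
          ≈⟨ ∑-cong (D l) (λ v → trans
               (∑-cong (D k) (λ u → solve 3 (λ a b x → a :* (b :* x) := b :* (a :* x)) refl _ _ _))
               (sym (∑-*ˡ (w l v) (D k) _))) ⟩
        ∑ (D l) (λ v → w l v * ∑ (D k) (λ u → w k u * choices ls (λ r → F v (u ∷ r)))) ∎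

    -- The bilinear form of `A k l` is assumed only for `k` before `l`: expansion along the first
    -- row never reads an entry below the diagonal. On a decreasing list of parts this is the range
    -- where `Qpair` is an honest Q-function.
    pf-choices : ∀ (A : K → K → Carrier) (B : I → I → Carrier) h {ks} → length ks ≡ dbl h →
      AllPairs (λ k l → A k l ≈ ∑ (D k) (λ u → ∑ (D l) (λ v → w k u * (w l v * B u v)))) ks →
      pf A h ks ≈ choices ks (pf B h)
    pf-choices A B zero    {[]}     len ps       = refl
    pf-choices A B (suc h) {k ∷ ks} len (p ∷ ps) = begin
      altΣ ks (λ l ls → A k l * pf A h ls)
        ≈⟨ altΣ-cong-AllPairs ps step ⟩
      altΣ ks (λ l ls → ∑ (D k) (λ u → w k u * ∑ (D l) (λ v → w l v * choices ls (λ r → B u v * pf B h r))))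
        ≈⟨ altΣ-∑ ks (D k) _ ⟨
      ∑ (D k) (λ u → altΣ ks (λ l ls → w k u * ∑ (D l) (λ v → w l v * choices ls (λ r → B u v * pf B h r))))
        ≈⟨ ∑-cong (D k) (λ u → trans (sym (altΣ-*ˡ (w k u) ks _)) (*-congˡ (sym (choices-altΣ ks _)))) ⟩
      choices (k ∷ ks) (pf B (suc h)) ∎
      where
      step : ∀ l ls → l ∷ ls ↭ ks → AllPairs _ ls → A k l * pf A h ls ≈
             ∑ (D k) (λ u → w k u * ∑ (D l) (λ v → w l v * choices ls (λ r → B u v * pf B h r)))
      step l ls q qs = begin
        A k l * pf A h ls
          ≈⟨ *-cong (All.head (All-resp-↭ (↭-sym q) p))
               (pf-choices A B h (ℕ.suc-injective (≡.trans (↭-length q) (ℕ.suc-injective len))) qs) ⟩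
        ∑ (D k) (λ u → ∑ (D l) (λ v → w k u * (w l v * B u v))) * X
          ≈⟨ trans (*-comm _ _) (∑-*ˡ X (D k) _) ⟩
        ∑ (D k) (λ u → X * ∑ (D l) (λ v → w k u * (w l v * B u v)))
          ≈⟨ ∑-cong (D k) (λ u → begin
               X * ∑ (D l) (λ v → w k u * (w l v * B u v))
                 ≈⟨ ∑-*ˡ X (D l) _ ⟩
               ∑ (D l) (λ v → X * (w k u * (w l v * B u v)))
                 ≈⟨ ∑-cong (D l) (λ v → trans
                      (solve 4 (λ x a b e → x :* (a :* (b :* e)) := a :* (b :* (e :* x))) refl _ _ _ _)
                      (*-congˡ (*-congˡ (choices-*ˡ (B u v) ls _)))) ⟩
               ∑ (D l) (λ v → w k u * (w l v * choices ls (λ r → B u v * pf B h r)))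
                 ≈⟨ ∑-*ˡ (w k u) (D l) _ ⟨
               w k u * ∑ (D l) (λ v → w l v * choices ls (λ r → B u v * pf B h r)) ∎) ⟩
        ∑ (D k) (λ u → w k u * ∑ (D l) (λ v → w l v * choices ls (λ r → B u v * pf B h r))) ∎
        where X = choices ls (pf B h)

  -- Schur's Pfaffian from the addition formula.

  -- e u v stands for (x_u + x_v)/(x_u − x_v) = coth (a_u − a_v), and e-triple is the
  -- addition formula of coth; nothing is ever divided by x_u + x_v, which may vanish.
  module Coth (e : I → I → Carrier)
    (e-skew : ∀ {u v} → u ≢ v → e u v ≈ - e v u)
    (e-triple : ∀ {u v w} → u ≢ v → v ≢ w → u ≢ w →
                e u v * e v w + e v w * e w u + e w u * e u v ≈ - 1#) where

    -- Partial fractions in the variable of `u`: a product with a common first index becomes linear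
    -- in `e u v` and `e u w`. This drives the induction for the sums below.
    e-mul : ∀ {u v w} → u ≢ v → u ≢ w → v ≢ w → e u v * e u w ≈ 1# + e w v * (e u w - e u v)
    e-mul {u} {v} {w} u≢v u≢w v≢w = begin
      e u v * e u w
        ≈⟨ *-congʳ (e-skew u≢v) ⟩
      - e v u * e u w
        ≈⟨ solve 3 (λ a b c → (:- c) :* a := (:- (a :* b :+ b :* c :+ c :* a)) :+ b :* (a :- :- c)) refl (e u w) (e w v) (e v u) ⟩
      - (e u w * e w v + e w v * e v u + e v u * e u w) + e w v * (e u w - - e v u)
        ≈⟨ +-cong (-‿cong (e-triple u≢w (λ p → v≢w (≡.sym p)) u≢v)) (*-congˡ (+-congˡ (-‿cong (sym (e-skew u≢v))))) ⟩
      - - 1# + e w v * (e u w - e u v)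
        ≈⟨ +-congʳ (solve 0 (:- :- con (+ 1) := con (+ 1)) refl) ⟩
      1# + e w v * (e u w - e u v) ∎

    e-mul′ : ∀ {u v w} → u ≢ v → u ≢ w → v ≢ w → e v u * e w u ≈ 1# + e v w * (e w u - e v u)
    e-mul′ {u} {v} {w} u≢v u≢w v≢w = begin
      e v u * e w u
        ≈⟨ *-cong (e-skew (λ p → u≢v (≡.sym p))) (e-skew (λ p → u≢w (≡.sym p))) ⟩
      - e u v * - e u w
        ≈⟨ solve 2 (λ a b → (:- a) :* (:- b) := a :* b) refl _ _ ⟩
      e u v * e u w
        ≈⟨ e-mul u≢v u≢w v≢w ⟩
      1# + e w v * (e u w - e u v)
        ≈⟨ +-congˡ (*-cong (e-skew (λ p → v≢w (≡.sym p))) (+-cong (e-skew u≢w) (-‿cong (e-skew u≢v)))) ⟩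
      1# + - e v w * (- e w u - - e v u)
        ≈⟨ solve 3 (λ a b c → con (+ 1) :+ (:- a) :* (:- b :- :- c) := con (+ 1) :+ a :* (b :- c)) refl _ _ _ ⟩
      1# + e v w * (e w u - e v u) ∎

    parity : List I → Carrier
    parity []       = 0#
    parity (_ ∷ us) = 1# - parity us

    -- `e-mul` removes `z` and `w` together. What multiplies `e w z` is the difference of the same
    -- sum for `w ∷ us` and for `z ∷ us`; both have length `suc n`, so they cancel. The induction is
    -- on the length because `z ∷ us` is not a subterm of `z ∷ w ∷ us`.
    selΣ-e : ∀ n us → length us ≡ n → Unique us → selΣ us (λ v r → ∏ r (e v)) ≈ parity us
    selΣ-e zero          []           len uus = refl
    selΣ-e (suc zero)    (x ∷ [])     len uus = solve 0 (con (+ 1) :+ con (+ 0) := con (+ 1) :- con (+ 0)) refl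
    selΣ-e (suc (suc n)) (z ∷ w ∷ us) len ((z≢w ∷ z∉us) ∷ w∉us ∷ uus) = begin
      e z w * Pz + (e w z * Pw + selΣ us (λ v r → e v z * (e v w * ∏ r (e v))))
        ≈⟨ +-cong (*-congʳ (e-skew z≢w)) (+-congˡ (selΣ-cong us expand)) ⟩
      - e w z * Pz + (e w z * Pw + selΣ us (λ v r → ∏ r (e v) + e w z * (e v w * ∏ r (e v) + - (1#) * (e v z * ∏ r (e v)))))
        ≈⟨ +-congˡ (+-congˡ (trans (selΣ-+ us _ _) (+-congˡ (trans (sym (selΣ-*ˡ (e w z) us _))
             (*-congˡ (trans (selΣ-+ us _ _) (+-congˡ (sym (selΣ-*ˡ (- 1#) us _))))))))) ⟩
      - e w z * Pz + (e w z * Pw + (S + e w z * (Sw + - 1# * Sz)))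
        ≈⟨ solve 6 (λ b pz pw s sw sz → (:- b) :* pz :+ (b :* pw :+ (s :+ b :* (sw :+ (:- con (+ 1)) :* sz)))
             := s :+ b :* ((pw :+ sw) :- (pz :+ sz))) refl _ _ _ _ _ _ ⟩
      S + e w z * ((Pw + Sw) - (Pz + Sz))
        ≈⟨ +-cong (selΣ-e n us (ℕ.suc-injective (ℕ.suc-injective len)) uus)
             (*-congˡ (+-cong (selΣ-e (suc n) (w ∷ us) (ℕ.suc-injective len) (w∉us ∷ uus))
                        (-‿cong (selΣ-e (suc n) (z ∷ us) (ℕ.suc-injective len) (z∉us ∷ uus))))) ⟩
      parity us + e w z * ((1# - parity us) - (1# - parity us))
        ≈⟨ solve 2 (λ p b → p :+ b :* ((con (+ 1) :- p) :- (con (+ 1) :- p)) := con (+ 1) :- (con (+ 1) :- p)) refl _ _ ⟩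
      1# - (1# - parity us) ∎
      where
      Pz = ∏ us (e z)
      Pw = ∏ us (e w)
      S  = selΣ us (λ v r → ∏ r (e v))
      Sw = selΣ us (λ v r → e v w * ∏ r (e v))
      Sz = selΣ us (λ v r → e v z * ∏ r (e v))
      expand : ∀ v r → v ∷ r ↭ us → e v z * (e v w * ∏ r (e v)) ≈
               ∏ r (e v) + e w z * (e v w * ∏ r (e v) + - 1# * (e v z * ∏ r (e v)))
      expand v r q = begin
        e v z * (e v w * ∏ r (e v))
          ≈⟨ *-assoc _ _ _ ⟨
        e v z * e v w * ∏ r (e v)
          ≈⟨ *-congʳ (e-mul (λ p → All.head (All-resp-↭ (↭-sym q) z∉us) (≡.sym p))
                            (λ p → All.head (All-resp-↭ (↭-sym q) w∉us) (≡.sym p)) z≢w) ⟩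
        (1# + e w z * (e v w - e v z)) * ∏ r (e v)
          ≈⟨ solve 4 (λ a b c p → (con (+ 1) :+ a :* (b :- c)) :* p := p :+ a :* (b :* p :+ (:- con (+ 1)) :* (c :* p))) refl _ _ _ _ ⟩
        ∏ r (e v) + e w z * (e v w * ∏ r (e v) + - 1# * (e v z * ∏ r (e v))) ∎

    -- The induction removes one index at a time and so alternates between the parities; the even
    -- case, with value 1 - ∏ e_zk, has to be carried along. Linearising `e z w * e v w` leaves only
    -- sums of the kind in `selΣ-e`.
    selΣ-ee : ∀ {z us} → All (z ≢_) us → Unique us →
              selΣ us (λ v r → ∏ r (λ k → e z k * e v k)) ≈ 1# - (1# - parity us) * ∏ us (e z)
    selΣ-ee []                            []           =
      solve 0 (con (+ 0) := con (+ 1) :- (con (+ 1) :- con (+ 0)) :* con (+ 1)) refl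
    selΣ-ee {z} {w ∷ us} (z≢w ∷ z∉us) (w∉us ∷ uus) = begin
      ∏ us (λ k → e z k * e w k) + selΣ us (λ v r → e z w * e v w * ∏ r (λ k → e z k * e v k))
        ≈⟨ +-cong (∏-* us (e z) (e w)) (selΣ-cong us expand) ⟩
      Z * ∏ us (e w) + selΣ us (λ v r → ∏ r (λ k → e z k * e v k) + (Z * (e v w * ∏ r (e v)) + - (Z * e z w) * ∏ r (e v)))
        ≈⟨ +-congˡ (trans (selΣ-+ us _ _) (+-congˡ (trans (selΣ-+ us _ _)
             (+-cong (sym (selΣ-*ˡ Z us _)) (sym (selΣ-*ˡ (- (Z * e z w)) us _)))))) ⟩
      Z * ∏ us (e w) + (H + (Z * Sw + - (Z * e z w) * S))
        ≈⟨ solve 6 (λ z p h s b t → z :* p :+ (h :+ (z :* s :+ (:- (z :* b)) :* t)) := h :+ z :* ((p :+ s) :- b :* t)) refl _ _ _ _ _ _ ⟩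
      H + Z * (selΣ (w ∷ us) (λ v r → ∏ r (e v)) - e z w * S)
        ≈⟨ +-cong (selΣ-ee z∉us uus) (*-congˡ (+-cong (selΣ-e _ (w ∷ us) ≡.refl (w∉us ∷ uus))
             (-‿cong (*-congˡ (selΣ-e _ us ≡.refl uus))))) ⟩
      1# - (1# - parity us) * Z + Z * ((1# - parity us) - e z w * parity us)
        ≈⟨ solve 3 (λ p z b → con (+ 1) :- (con (+ 1) :- p) :* z :+ z :* ((con (+ 1) :- p) :- b :* p)
             := con (+ 1) :- (con (+ 1) :- (con (+ 1) :- p)) :* (b :* z)) refl _ _ _ ⟩
      1# - (1# - (1# - parity us)) * (e z w * Z) ∎
      where
      Z  = ∏ us (e z)
      H  = selΣ us (λ v r → ∏ r (λ k → e z k * e v k))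
      S  = selΣ us (λ v r → ∏ r (e v))
      Sw = selΣ us (λ v r → e v w * ∏ r (e v))
      expand : ∀ v r → v ∷ r ↭ us → e z w * e v w * ∏ r (λ k → e z k * e v k) ≈
               ∏ r (λ k → e z k * e v k) + (Z * (e v w * ∏ r (e v)) + - (Z * e z w) * ∏ r (e v))
      expand v r q = begin
        e z w * e v w * ∏ r (λ k → e z k * e v k)
          ≈⟨ *-congʳ (e-mul′ (λ p → z≢w (≡.sym p)) (All.head (All-resp-↭ (↭-sym q) w∉us)) (All.head (All-resp-↭ (↭-sym q) z∉us))) ⟩
        (1# + e z v * (e v w - e z w)) * X
          ≈⟨ solve 4 (λ a b c x → (con (+ 1) :+ a :* (b :- c)) :* x := x :+ a :* (b :- c) :* x) refl _ _ _ _ ⟩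
        X + e z v * (e v w - e z w) * X
          ≈⟨ +-congˡ (*-congˡ (∏-* r (e z) (e v))) ⟩
        X + e z v * (e v w - e z w) * (∏ r (e z) * ∏ r (e v))
          -- The new factor `e z v` completes the product over `r` to the one over all of `us`,
          -- which no longer depends on `v` and leaves the sum.
          ≈⟨ +-congˡ (solve 5 (λ a b c y p → a :* (b :- c) :* (y :* p) := a :* y :* (b :* p) :+ (:- (a :* y :* c)) :* p) refl _ _ _ _ _) ⟩
        X + (∏ (v ∷ r) (e z) * (e v w * ∏ r (e v)) + - (∏ (v ∷ r) (e z) * e z w) * ∏ r (e v))
          ≈⟨ +-congˡ (+-cong (*-congʳ Z≈) (*-congʳ (-‿cong (*-congʳ Z≈)))) ⟩
        X + (Z * (e v w * ∏ r (e v)) + - (Z * e z w) * ∏ r (e v)) ∎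
        where
        X = ∏ r (λ k → e z k * e v k)
        Z≈ : ∏ (v ∷ r) (e z) ≈ Z
        Z≈ = ∏-↭ (e z) q

    ∏-e : List I → Carrier
    ∏-e []       = 1#
    ∏-e (u ∷ us) = ∏ us (e u) * ∏-e us

    -- Moving `v` to the front of `∏-e us` reverses one factor for every entry that precedes it. The
    -- resulting sign is that of its position and cancels the alternation.
    altΣ-∏-e : ∀ us → Unique us → ∀ G →
               altΣ us (λ v r → ∏ r (e v) * ∏-e r * G v r) ≈ ∏-e us * selΣ us G
    altΣ-∏-e []       []           G = sym (zeroʳ _)
    altΣ-∏-e (x ∷ us) (x∉us ∷ uus) G = begin
      P * E * G x us - altΣ us (λ v r → e v x * ∏ r (e v) * (∏ r (e x) * ∏-e r) * G v (x ∷ r))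
        ≈⟨ +-congˡ (-‿cong (trans (altΣ-cong us flip) (altΣ-neg us _))) ⟩
      P * E * G x us - - altΣ us (λ v r → ∏ r (e v) * ∏-e r * (P * G v (x ∷ r)))
        ≈⟨ +-congˡ (-‿cong (-‿cong (trans (altΣ-∏-e us uus _) (*-congˡ (sym (selΣ-*ˡ P us _)))))) ⟩
      P * E * G x us - - (E * (P * selΣ us (λ v r → G v (x ∷ r))))
        ≈⟨ solve 4 (λ p e g s → p :* e :* g :- :- (e :* (p :* s)) := p :* e :* (g :+ s)) refl _ _ _ _ ⟩
      P * E * selΣ (x ∷ us) G ∎
      where
      P = ∏ us (e x)
      E = ∏-e us
      flip : ∀ v r → v ∷ r ↭ us → e v x * ∏ r (e v) * (∏ r (e x) * ∏-e r) * G v (x ∷ r) ≈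
             - (∏ r (e v) * ∏-e r * (P * G v (x ∷ r)))
      flip v r q = begin
        e v x * ∏ r (e v) * (∏ r (e x) * ∏-e r) * G v (x ∷ r)
          ≈⟨ *-congʳ (*-congʳ (*-congʳ (e-skew (λ p → All.head (All-resp-↭ (↭-sym q) x∉us) (≡.sym p))))) ⟩
        - e x v * ∏ r (e v) * (∏ r (e x) * ∏-e r) * G v (x ∷ r)
          ≈⟨ solve 5 (λ a b c d g → (:- a) :* b :* (c :* d) :* g := :- (b :* d :* (a :* c :* g))) refl _ _ _ _ _ ⟩
        - (∏ r (e v) * ∏-e r * (∏ (v ∷ r) (e x) * G v (x ∷ r)))
          ≈⟨ -‿cong (*-congˡ (*-congʳ (∏-↭ (e x) q))) ⟩
        - (∏ r (e v) * ∏-e r * (P * G v (x ∷ r))) ∎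

    parity-odd : ∀ h us → length us ≡ suc (dbl h) → parity us ≈ 1#
    parity-odd zero    (x ∷ [])     len = solve 0 (con (+ 1) :- con (+ 0) := con (+ 1)) refl
    parity-odd (suc h) (x ∷ y ∷ us) len = trans
      (solve 1 (λ p → con (+ 1) :- (con (+ 1) :- p) := p) refl _)
      (parity-odd h us (ℕ.suc-injective (ℕ.suc-injective len)))

    -- Schur's Pfaffian of (x_u − x_v)/(x_u + x_v), with rows and columns rescaled so that
    -- only the inverses e of its entries occur.
    pf-schur : ∀ (A : I → I → Carrier) h us → length us ≡ dbl h → Unique us → ∀ r →
      (∀ u v rest → u ∷ v ∷ rest ↭ us → A u v ≈ e u v * (∏ rest (λ k → e u k * e v k) * (r u * r v))) →
      pf A h us ≈ ∏-e us * ∏ us r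
    pf-schur A zero    []       len uus          r hyp = sym (*-identityˡ _)
    pf-schur A (suc h) (u ∷ us) len (u∉us ∷ uus) r hyp = begin
      altΣ us (λ v rest → A u v * pf A h rest)
        ≈⟨ altΣ-cong us term ⟩
      altΣ us (λ v rest → ∏ rest (e v) * ∏-e rest * (W * ∏ rest (λ k → e u k * e v k)))
        ≈⟨ altΣ-∏-e us uus _ ⟩
      ∏-e us * selΣ us (λ v rest → W * ∏ rest (λ k → e u k * e v k))
        ≈⟨ *-congˡ (trans (sym (selΣ-*ˡ W us _)) (*-congˡ (selΣ-ee u∉us uus))) ⟩
      ∏-e us * (W * (1# - (1# - parity us) * ∏ us (e u)))
        -- With `u` removed the list has odd length, so the correction term of `selΣ-ee` disappears.
        ≈⟨ *-congˡ (*-congˡ (+-congˡ (-‿cong (*-congʳ (+-congˡ (-‿cong (parity-odd h us (ℕ.suc-injective len)))))))) ⟩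
      ∏-e us * (W * (1# - (1# - 1#) * ∏ us (e u)))
        ≈⟨ solve 4 (λ E p a b → E :* ((p :* (a :* b)) :* (con (+ 1) :- (con (+ 1) :- con (+ 1)) :* p)) := p :* E :* (a :* b)) refl _ _ _ _ ⟩
      ∏-e (u ∷ us) * ∏ (u ∷ us) r ∎
      where
      W = ∏ us (e u) * (r u * ∏ us r)
      term : ∀ v rest → v ∷ rest ↭ us → A u v * pf A h rest ≈
             ∏ rest (e v) * ∏-e rest * (W * ∏ rest (λ k → e u k * e v k))
      term v rest q with Unique-resp-↭ (↭-sym q) uus
      ... | v∉rest ∷ urest with All-resp-↭ (↭-sym q) u∉us
      ... | u≢v ∷ u∉rest = begin
        A u v * pf A h rest
          ≈⟨ *-cong (hyp u v rest (prep u q)) (pf-schur A h rest len′ urest r′ hyp′) ⟩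
        e u v * (X * (r u * r v)) * (∏-e rest * ∏ rest r′)
          ≈⟨ *-congˡ (*-congˡ (trans (∏-* rest r _) (*-congˡ (∏-cong-All (All.zipWith signs (u∉rest , v∉rest)))))) ⟩
        e u v * (X * (r u * r v)) * (∏-e rest * (∏ rest r * X))
          ≈⟨ *-congʳ (*-congˡ (*-congʳ (∏-* rest (e u) (e v)))) ⟩
        e u v * ((∏ rest (e u) * ∏ rest (e v)) * (r u * r v)) * (∏-e rest * (∏ rest r * X))
          ≈⟨ solve 8 (λ a p q s t E y x → a :* ((p :* q) :* (s :* t)) :* (E :* (y :* x))
               := q :* E :* (((a :* p) :* (s :* (t :* y))) :* x)) refl _ _ _ _ _ _ _ _ ⟩
        ∏ rest (e v) * ∏-e rest * (∏ (v ∷ rest) (e u) * (r u * ∏ (v ∷ rest) r) * X)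
          ≈⟨ *-congˡ (*-congʳ (*-cong (∏-↭ (e u) q) (*-congˡ (∏-↭ r q)))) ⟩
        ∏ rest (e v) * ∏-e rest * (W * X) ∎
        where
        X = ∏ rest (λ k → e u k * e v k)
        -- Seen from the smaller Pfaffian, the indices `u` and `v` are no longer among the remaining
        -- ones. Their factors in an entry split into one for its row and one for its column, hence
        -- pass into the scaling; this is why an arbitrary scaling `r` is allowed.
        r′ : I → Carrier
        r′ p = r p * (e p u * e p v)
        len′ : length rest ≡ dbl h
        len′ = ℕ.suc-injective (≡.trans (↭-length q) (ℕ.suc-injective len))
        signs : ∀ {p} → (u ≢ p) × (v ≢ p) → e p u * e p v ≈ e u p * e v p
        signs (u≢p , v≢p) = trans (*-cong (e-skew (λ s → u≢p (≡.sym s))) (e-skew (λ s → v≢p (≡.sym s))))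
          (solve 2 (λ a b → (:- a) :* (:- b) := a :* b) refl _ _)
        hyp′ : ∀ p q′ rest′ → p ∷ q′ ∷ rest′ ↭ rest →
               A p q′ ≈ e p q′ * (∏ rest′ (λ k → e p k * e q′ k) * (r′ p * r′ q′))
        hyp′ p p′ rest′ s = trans
          (hyp p p′ (u ∷ v ∷ rest′) (↭-trans (move p p′ rest′) (prep u (↭-trans (prep v s) q))))
          (*-congˡ (solve 7 (λ a b c d x s t → (a :* b :* (c :* d :* x)) :* (s :* t)
             := x :* ((s :* (a :* c)) :* (t :* (b :* d)))) refl _ _ _ _ _ _ _))
          where
          move : ∀ p p′ rest′ → p ∷ p′ ∷ u ∷ v ∷ rest′ ↭ u ∷ v ∷ p ∷ p′ ∷ rest′
          move p p′ rest′ = ↭-trans (prep p (swap p′ u ↭.refl)) (↭-trans (swap p u ↭.refl)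
            (prep u (↭-trans (prep p (swap p′ v ↭.refl)) (swap p v ↭.refl))))

Unique-++ˡ : ∀ {A : Set} (us : List A) {vs} → Unique (us ++ vs) → Unique us
Unique-++ˡ []       uus        = []
Unique-++ˡ (u ∷ us) (p ∷ uus) = All.++⁻ˡ us p ∷ Unique-++ˡ us uus

¬uniqᵇ⇒Repeats : ∀ {k} (us : List (Fin k)) → uniqᵇ us ≡ false → Repeats us
¬uniqᵇ⇒Repeats (u ∷ us) eq with allᵇ (neqᵇ u) us in all
... | true  = there (¬uniqᵇ⇒Repeats us eq)
... | false = here (member us all)
  where
  member : ∀ us → allᵇ (neqᵇ u) us ≡ false → u ∈ us
  member (v ∷ us) eq with u Fin.≟ v
  ... | yes p   = here p
  ... | no  u≢v rewrite neqᵇ-≢ u≢v = there (member us eq)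

Repeats-map : ∀ {A B : Set} (f : A → B) {us} → Repeats us → Repeats (map f us)
Repeats-map f (here u∈us) = here (∈-map⁺ f u∈us)
Repeats-map f (there r)   = there (Repeats-map f r)

Repeats-++ˡ : ∀ {A : Set} {us vs : List A} → Repeats us → Repeats (us ++ vs)
Repeats-++ˡ (here u∈us) = here (∈-++⁺ˡ u∈us)
Repeats-++ˡ (there r)   = there (Repeats-++ˡ r)

[1+dbl]/2 : ∀ h → suc (dbl h) / 2 ≡ h
[1+dbl]/2 zero    = ≡.refl
[1+dbl]/2 (suc h) = ≡.trans (m/n≡1+[m∸n]/n {suc (dbl (suc h))} {2} (s≤s (s≤s z≤n))) (cong suc ([1+dbl]/2 h))

dbl/2 : ∀ h → dbl h / 2 ≡ h
dbl/2 zero    = ≡.refl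
dbl/2 (suc h) = ≡.trans (m/n≡1+[m∸n]/n {dbl (suc h)} {2} (s≤s (s≤s z≤n))) (cong suc (dbl/2 h))

even-or-odd : ∀ n → ∃ λ h → n ≡ dbl h ⊎ n ≡ suc (dbl h)
even-or-odd zero = zero , inj₁ ≡.refl
even-or-odd (suc n) with even-or-odd n
... | h , inj₁ p = h , inj₂ (cong suc p)
... | h , inj₂ p = suc h , inj₁ (cong suc p)

map-nth-ix : ∀ μ → map (nth μ) (ix (length μ)) ≡ μ
map-nth-ix []      = ≡.refl
map-nth-ix (k ∷ μ) = ≡.trans (cong (map (nth (k ∷ μ))) (ix-suc (length μ)))
  (cong (k ∷_) (≡.trans (≡.sym (List.map-∘ (ix (length μ)))) (map-nth-ix μ)))

-- `nth` returns 0 just past the end, which is the convention that the part after the last one is 0.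
map-nth-ix-suc : ∀ μ → map (nth μ) (ix (suc (length μ))) ≡ μ ++ [ 0 ]
map-nth-ix-suc []      = ≡.refl
map-nth-ix-suc (k ∷ μ) = ≡.trans (cong (map (nth (k ∷ μ))) (ix-suc (suc (length μ))))
  (cong (k ∷_) (≡.trans (≡.sym (List.map-∘ (ix (suc (length μ))))) (map-nth-ix-suc μ)))

-- Q-functions as sums over injections of rows into variables.

module QFunctions {c ℓ : Level} (R : CommutativeRing c ℓ) where
  open CommutativeRing R hiding (zero)
  open PfaffianTheory R public
  open import Relation.Binary.Reasoning.Setoid setoid

  fromℕ-+ : ∀ m n → fromℕ R (m ℕ.+ n) ≈ fromℕ R m + fromℕ R n
  fromℕ-+ zero    n = sym (+-identityˡ _)
  fromℕ-+ (suc m) n = trans (+-congˡ (fromℕ-+ m n)) (sym (+-assoc _ _ _))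

  fromℕ-* : ∀ m n → fromℕ R (m ℕ.* n) ≈ fromℕ R m * fromℕ R n
  fromℕ-* zero    n = sym (zeroˡ _)
  fromℕ-* (suc m) n = trans (fromℕ-+ n (m ℕ.* n)) (trans (+-congˡ (fromℕ-* m n))
    (solve 2 (λ m n → n :+ m :* n := (con (+ 1) :+ m) :* n) refl _ _))

  ∑-const : ∀ {A : Set} (S : List A) k → ∑ S (λ _ → k) ≈ fromℕ R (length S) * k
  ∑-const []      k = sym (zeroˡ _)
  ∑-const (_ ∷ S) k = trans (+-congˡ (∑-const S k))
    (solve 2 (λ n k → k :+ n :* k := (con (+ 1) :+ n) :* k) refl _ _)

  arr-count : ∀ {A : Set} r (S : List A) → length S ≡ r → arr r S (λ _ _ → 1#) ≈ fromℕ R (r !)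
  arr-count zero    S l = sym (+-identityʳ _)
  arr-count (suc r) S l = begin
    selΣ S (λ u S′ → arr r S′ (λ _ _ → 1#))
      ≈⟨ selΣ-cong S (λ u S′ q → arr-count r S′ (ℕ.suc-injective (≡.trans (↭-length q) l))) ⟩
    selΣ S (λ _ _ → fromℕ R (r !))
      ≈⟨ trans (selΣ-∑ S _) (∑-const S _) ⟩
    fromℕ R (length S) * fromℕ R (r !)
      ≈⟨ *-congʳ (reflexive (cong (fromℕ R) l)) ⟩
    fromℕ R (suc r) * fromℕ R (r !)
      ≈⟨ fromℕ-* (suc r) (r !) ⟨
    fromℕ R (suc r !) ∎

  -- The entries run out before `n` of them are picked. This matches the convention that P vanishes
  -- when there are fewer variables than parts.
  arr-short : ∀ {A : Set} n (S : List A) g → length S < n → arr n S g ≈ 0#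
  arr-short (suc n) S g l = trans
    (selΣ-cong S (λ u S′ q → arr-short n S′ _ (ℕ.≤-pred (≡.subst (_< suc n) (≡.sym (↭-length q)) l))))
    (selΣ-0 S)

  pf-map : ∀ {I J : Set} (f : I → J) (B : J → J → Carrier) h is →
           pf (λ i j → B (f i) (f j)) h is ≈ pf B h (map f is)
  pf-map f B zero    []       = refl
  pf-map f B zero    (_ ∷ _)  = refl
  pf-map f B (suc h) []       = refl
  pf-map f B (suc h) (i ∷ is) = trans
    (altΣ-cong is (λ j js _ → *-congˡ (pf-map f B h js)))
    (sym (altΣ-map f is _))

  ∏-suc : ∀ {n} (f : Fin (suc n) → Carrier) → ∏ (allFin (suc n)) f ≈ f zero * ∏ (allFin n) (λ i → f (suc i))
  ∏-suc {n} f = *-congˡ (trans (reflexive (cong (λ l → ∏ l f) (tabulate-allFin suc))) (∏-map suc (allFin n) f))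

  ∏-allFin : ∀ {n} {A : Set} (g : A → Carrier) (f : Fin n → A) → ∏ (allFin n) (λ i → g (f i)) ≈ ∏ (tabulate f) g
  ∏-allFin {n} g f = trans (sym (∏-map f (allFin n) g)) (reflexive (cong (λ l → ∏ l g) (≡.sym (tabulate-allFin f))))

  module Evaluation
    (inv : Carrier → Carrier)
    (inverse : ∀ y → ¬ (y ≈ 0#) → y * inv y ≈ 1#)
    (char0 : ∀ n → ¬ (fromℕ R (suc n) ≈ 0#))
    (a : ℕ → Carrier) {m : ℕ} (x : Fin m → Carrier)
    (x-inj : ∀ i j → x i ≈ x j → i ≡ j) where

    S : List (Fin m)
    S = allFin m

    uS : Unique S
    uS = Unique.allFin⁺ m

    d e : Fin m → Fin m → Carrier
    d u v = x u - x v
    e u v = (x u + x v) * inv (x u - x v)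

    d-inv : ∀ {u v} → u ≢ v → d u v * inv (d u v) ≈ 1#
    d-inv {u} {v} u≢v = inverse _ λ p → u≢v (x-inj u v (begin
      x u             ≈⟨ solve 2 (λ a b → a := (a :- b) :+ b) refl _ _ ⟩
      x u - x v + x v ≈⟨ +-congʳ p ⟩
      0# + x v        ≈⟨ +-identityˡ _ ⟩
      x v             ∎))

    e-skew : ∀ {u v} → u ≢ v → e u v ≈ - e v u
    e-skew {u} {v} u≢v = begin
      (x u + x v) * i
        -- `inv` is known only through `y * inv y ≈ 1#`, so the inverses of a difference and of its
        -- negative are compared by inserting the latter times its inverse.
        ≈⟨ *-identityʳ _ ⟨
      (x u + x v) * i * 1#
        ≈⟨ *-congˡ (d-inv (λ p → u≢v (≡.sym p))) ⟨
      (x u + x v) * i * ((x v - x u) * j)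
        ≈⟨ solve 4 (λ a b i j → (a :+ b) :* i :* ((b :- a) :* j) := :- ((b :+ a) :* j :* ((a :- b) :* i))) refl _ _ _ _ ⟩
      - ((x v + x u) * j * ((x u - x v) * i))
        ≈⟨ -‿cong (trans (*-congˡ (d-inv u≢v)) (*-identityʳ _)) ⟩
      - ((x v + x u) * j) ∎
      where
      i = inv (x u - x v)
      j = inv (x v - x u)

    e-triple : ∀ {u v w} → u ≢ v → v ≢ w → u ≢ w →
               e u v * e v w + e v w * e w u + e w u * e u v ≈ - 1#
    e-triple {u} {v} {w} u≢v v≢w u≢w = begin
      e u v * e v w + e v w * e w u + e w u * e u v
        -- Each product receives the missing difference times its inverse. All three terms then
        -- share the same inverses, and a polynomial identity between numerators remains.
        ≈⟨ +-cong (+-cong (unit p₃) (unit p₁)) (unit p₂) ⟩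
      e u v * e v w * (d w u * i w u) + e v w * e w u * (d u v * i u v) + e w u * e u v * (d v w * i v w)
        ≈⟨ solve 6 (λ a b c p q r →
             ((a :+ b) :* p) :* ((b :+ c) :* q) :* ((c :- a) :* r) :+
             ((b :+ c) :* q) :* ((c :+ a) :* r) :* ((a :- b) :* p) :+
             ((c :+ a) :* r) :* ((a :+ b) :* p) :* ((b :- c) :* q)
             := :- (((a :- b) :* p) :* (((b :- c) :* q) :* ((c :- a) :* r)))) refl
             (x u) (x v) (x w) (i u v) (i v w) (i w u) ⟩
      - (d u v * i u v * (d v w * i v w * (d w u * i w u)))
        ≈⟨ -‿cong (trans (*-cong p₁ (trans (*-cong p₂ p₃) (*-identityˡ _))) (*-identityˡ _)) ⟩
      - 1# ∎
      where
      i : Fin m → Fin m → Carrier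
      i u v = inv (d u v)
      p₁ = d-inv u≢v
      p₂ = d-inv v≢w
      p₃ = d-inv (λ p → u≢w (≡.sym p))
      unit : ∀ {y z} → y ≈ 1# → z ≈ z * y
      unit p = sym (trans (*-congˡ p) (*-identityʳ _))

    summand : List ℕ → List (Fin m) → Carrier
    summand []      us       = 1#
    summand (k ∷ μ) []       = 1#
    summand (k ∷ μ) (u ∷ us) = factPow R inv a (x u) k * ∏ us (e u) * summand μ us

    above : ∀ {n} → (Fin n → Fin m) → Fin n → Fin n → Carrier
    above ω i j = if toℕ i <ᵇ toℕ j then e (ω i) (ω j) else 1#

    factor : List ℕ → ∀ {n} → (Fin n → Fin m) → Fin n → Carrier
    factor μ {n} ω i =
      if toℕ i <ᵇ length μ
      then factPow R inv a (x (ω i)) (nth μ (toℕ i)) * ∏ (allFin n) (above ω i)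
      else 1#

    ∏-above-suc : ∀ {n} (ω : Fin (suc n) → Fin m) i →
                  ∏ (allFin (suc n)) (above ω (suc i)) ≈ ∏ (allFin n) (above (λ j → ω (suc j)) i)
    ∏-above-suc ω i = trans (∏-suc (above ω (suc i))) (*-identityˡ _)

    ∏-factor : ∀ μ {n} (ω : Fin n → Fin m) → ∏ (allFin n) (factor μ ω) ≈ summand μ (tabulate ω)
    ∏-factor []      {n}     ω = ∏-1 (allFin n)
    ∏-factor (k ∷ μ) {zero}  ω = refl
    ∏-factor (k ∷ μ) {suc n} ω = trans (∏-suc (factor (k ∷ μ) ω)) (*-cong
      (*-congˡ (trans (∏-suc (above ω zero)) (trans (*-identityˡ _) (∏-allFin (e (ω zero)) (λ j → ω (suc j))))))
      (trans (∏-cong (allFin n) shift-factor) (∏-factor μ (λ j → ω (suc j)))))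
      where
      shift-factor : ∀ i → factor (k ∷ μ) ω (suc i) ≈ factor μ (λ j → ω (suc j)) i
      shift-factor i with toℕ i <ᵇ length μ
      ... | true  = *-congˡ (∏-above-suc ω i)
      ... | false = refl

    -- The summand of P_μ attached to an injection us of the rows of μ into the variables,
    -- rem being the variables not hit.
    partial : List ℕ → List (Fin m) → List (Fin m) → Carrier
    partial []      us       rem = 1#
    partial (k ∷ μ) []       rem = 1#
    partial (k ∷ μ) (u ∷ us) rem =
      factPow R inv a (x u) k * (∏ us (e u) * ∏ rem (e u)) * partial μ us rem

    -- The entries after the last row enter only through products over all of them, so their r!
    -- orders contribute equally. This is the factor that the prefactor 1/(m - l)! of P removes.
    arr-summand : ∀ μ r T → length T ≡ length μ ℕ.+ r →
      arr (length μ ℕ.+ r) T (λ us _ → summand μ us) ≈ fromℕ R (r !) * arr (length μ) T (partial μ)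
    arr-summand []      r T l = trans (arr-count r T l) (sym (*-identityʳ _))
    arr-summand (k ∷ μ) r T l = begin
      selΣ T (λ u T′ → arr (length μ ℕ.+ r) T′ (λ us _ → f u * ∏ us (e u) * summand μ us))
        ≈⟨ selΣ-cong T step ⟩
      selΣ T (λ u T′ → fromℕ R (r !) * arr (length μ) T′ (λ us → partial (k ∷ μ) (u ∷ us)))
        ≈⟨ selΣ-*ˡ _ T _ ⟨
      fromℕ R (r !) * arr (suc (length μ)) T (partial (k ∷ μ)) ∎
      where
      f : Fin m → Carrier
      f u = factPow R inv a (x u) k
      step : ∀ u T′ → u ∷ T′ ↭ T →
        arr (length μ ℕ.+ r) T′ (λ us _ → f u * ∏ us (e u) * summand μ us) ≈
        fromℕ R (r !) * arr (length μ) T′ (λ us → partial (k ∷ μ) (u ∷ us))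
      step u T′ q = begin
        arr (length μ ℕ.+ r) T′ (λ us _ → f u * ∏ us (e u) * summand μ us)
          ≈⟨ arr-cong (length μ ℕ.+ r) T′ (λ us rem lu p →
               *-congʳ (*-congˡ (∏-↭ (e u) (++-full {us = us} p (≡.trans lu (≡.sym l′)))))) ⟩
        arr (length μ ℕ.+ r) T′ (λ us _ → f u * ∏ T′ (e u) * summand μ us)
          ≈⟨ arr-*ˡ _ (length μ ℕ.+ r) T′ _ ⟨
        f u * ∏ T′ (e u) * arr (length μ ℕ.+ r) T′ (λ us _ → summand μ us)
          ≈⟨ *-congˡ (arr-summand μ r T′ l′) ⟩
        f u * ∏ T′ (e u) * (fromℕ R (r !) * arr (length μ) T′ (partial μ))
          ≈⟨ solve 3 (λ a b c → a :* (b :* c) := b :* (a :* c)) refl _ _ _ ⟩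
        fromℕ R (r !) * (f u * ∏ T′ (e u) * arr (length μ) T′ (partial μ))
          ≈⟨ *-congˡ (trans (arr-*ˡ _ (length μ) T′ _) (arr-cong (length μ) T′ (λ us rem lu p →
               *-congʳ (*-congˡ (trans (sym (∏-↭ (e u) p)) (∏-++ us rem (e u))))))) ⟩
        fromℕ R (r !) * arr (length μ) T′ (λ us → partial (k ∷ μ) (u ∷ us)) ∎
        where
        l′ : length T′ ≡ length μ ℕ.+ r
        l′ = ℕ.suc-injective (≡.trans (↭-length q) l)

    !-inverse : ∀ r → fromℕ R (r !) * inv (fromℕ R (r !)) ≈ 1#
    !-inverse r with r ! | ℕ._!≢0 r
    ... | suc n | _ = inverse _ (char0 n)

    Pval-arr : ∀ μ → Pval R inv a μ m x ≈ arr (length μ) S (partial μ)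
    Pval-arr μ with length μ ≤ᵇ m in le
    ... | false = sym (arr-short (length μ) S _ (≡.subst (_< length μ) (≡.sym (List.length-tabulate _))
                    (ℕ.≰⇒> λ p → ≡.subst Bool.T le (ℕ.≤⇒≤ᵇ p))))
    ... | true  = begin
      inv (fromℕ R (r !)) * ∑ (perms m) (λ ω → ∏ S (factor μ ω))
        ≈⟨ *-congˡ (trans (∑-cong (perms m) (∏-factor μ)) (∑-perms m (summand μ))) ⟩
      inv (fromℕ R (r !)) * arr m S (λ us _ → summand μ us)
        ≈⟨ *-congˡ (reflexive (cong (λ n → arr n S (λ us _ → summand μ us)) (≡.sym m≡))) ⟩
      inv (fromℕ R (r !)) * arr (length μ ℕ.+ r) S (λ us _ → summand μ us)
        ≈⟨ *-congˡ (arr-summand μ r S (≡.trans (List.length-tabulate _) (≡.sym m≡))) ⟩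
      inv (fromℕ R (r !)) * (fromℕ R (r !) * arr (length μ) S (partial μ))
        ≈⟨ solve 3 (λ i f y → i :* (f :* y) := (f :* i) :* y) refl _ _ _ ⟩
      fromℕ R (r !) * inv (fromℕ R (r !)) * arr (length μ) S (partial μ)
        ≈⟨ trans (*-congʳ (!-inverse r)) (*-identityˡ _) ⟩
      arr (length μ) S (partial μ) ∎
      where
      r = m ∸ length μ
      m≡ : length μ ℕ.+ r ≡ m
      m≡ = ℕ.m+[n∸m]≡n (ℕ.≤ᵇ⇒≤ (length μ) m (≡.subst Bool.T (≡.sym le) _))

    -- The extra point for odd length, the matrix `B` and the row weights.

    -- The point nothing is the variable 0, which pads partitions of odd length.
    ê : Maybe (Fin m) → Maybe (Fin m) → Carrier
    ê (just u) (just v) = e u v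
    ê (just u) nothing  = 1#
    ê nothing  (just v) = - 1#
    ê nothing  nothing  = 0#

    ê-skew : ∀ {u v} → u ≢ v → ê u v ≈ - ê v u
    ê-skew {just u}  {just v}  u≢v = e-skew (λ p → u≢v (cong just p))
    ê-skew {just u}  {nothing} u≢v = solve 0 (con (+ 1) := :- :- con (+ 1)) refl
    ê-skew {nothing} {just v}  u≢v = refl
    ê-skew {nothing} {nothing} u≢v = ⊥-elim (u≢v ≡.refl)

    ê-triple : ∀ {u v w} → u ≢ v → v ≢ w → u ≢ w →
               ê u v * ê v w + ê v w * ê w u + ê w u * ê u v ≈ - 1#
    ê-triple {just u}  {just v}  {just w}  p q r = e-triple (λ s → p (cong just s)) (λ s → q (cong just s)) (λ s → r (cong just s))
    ê-triple {just u}  {just v}  {nothing} p q r =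
      solve 1 (λ y → y :* con (+ 1) :+ con (+ 1) :* (:- con (+ 1)) :+ (:- con (+ 1)) :* y := :- con (+ 1)) refl _
    ê-triple {just u}  {nothing} {just w}  p q r =
      solve 1 (λ y → con (+ 1) :* (:- con (+ 1)) :+ (:- con (+ 1)) :* y :+ y :* con (+ 1) := :- con (+ 1)) refl _
    ê-triple {nothing} {just v}  {just w}  p q r =
      solve 1 (λ y → (:- con (+ 1)) :* y :+ y :* con (+ 1) :+ con (+ 1) :* (:- con (+ 1)) := :- con (+ 1)) refl _
    ê-triple {just u}  {nothing} {nothing} p q r = ⊥-elim (q ≡.refl)
    ê-triple {nothing} {just v}  {nothing} p q r = ⊥-elim (r ≡.refl)
    ê-triple {nothing} {nothing} {w}       p q r = ⊥-elim (p ≡.refl)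

    open Coth ê ê-skew ê-triple

    skip : Fin m → (Fin m → Carrier) → Fin m → Carrier
    skip u f k with u Fin.≟ k
    ... | yes _ = 1#
    ... | no  _ = f k

    ∏-skip : ∀ {T u rest} f → Unique T → u ∷ rest ↭ T → ∏ T (skip u f) ≈ ∏ rest f
    ∏-skip {T} {u} {rest} f uT p with Unique-resp-↭ (↭-sym p) uT
    ... | u∉rest ∷ _ = begin
      ∏ T (skip u f)                 ≈⟨ ∏-↭ _ p ⟨
      skip u f u * ∏ rest (skip u f) ≈⟨ *-cong skip-≡ (∏-cong-All (All.map skip-≢ u∉rest)) ⟩
      1# * ∏ rest f                  ≈⟨ *-identityˡ _ ⟩
      ∏ rest f                       ∎
      where
      skip-≡ : skip u f u ≈ 1#
      skip-≡ with u Fin.≟ u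
      ... | yes _ = refl
      ... | no  n = ⊥-elim (n ≡.refl)
      skip-≢ : ∀ {k} → u ≢ k → skip u f k ≈ f k
      skip-≢ {k} u≢k with u Fin.≟ k
      ... | yes p = ⊥-elim (u≢k p)
      ... | no  _ = refl

    others : Fin m → Fin m → Carrier
    others u v = ∏ S (skip u (skip v (λ k → e u k * e v k)))

    others-sym : ∀ u v → others u v ≈ others v u
    others-sym u v = ∏-cong S pointwise
      where
      pointwise : ∀ k → skip u (skip v (λ k → e u k * e v k)) k ≈ skip v (skip u (λ k → e v k * e u k)) k
      pointwise k with u Fin.≟ k in p | v Fin.≟ k in q
      ... | yes _ | yes _ = refl
      ... | yes _ | no  _ rewrite p = refl
      ... | no  _ | yes _ rewrite q = refl
      ... | no  _ | no  _ rewrite p | q = *-comm _ _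

    -- The row of `nothing` belongs to the padding part 0. Its entries leave out the signs
    -- `ê nothing k`, so that pairing the row of a part k with it gives Q_(k). The diagonal is set
    -- to zero to make the matrix skew.
    B : Maybe (Fin m) → Maybe (Fin m) → Carrier
    B (just u) (just v) with u Fin.≟ v
    ... | yes _ = 0#
    ... | no  _ = e u v * others u v
    B (just u) nothing  = ∏ S (skip u (e u))
    B nothing  (just v) = - ∏ S (skip v (e v))
    B nothing  nothing  = 0#

    B-skew : ∀ u v → B u v ≈ - B v u
    B-skew (just u) (just v) with u Fin.≟ v | v Fin.≟ u
    ... | yes _ | yes _ = solve 0 (con (+ 0) := :- con (+ 0)) refl
    ... | yes p | no  n = ⊥-elim (n (≡.sym p))
    ... | no  n | yes p = ⊥-elim (n (≡.sym p))
    ... | no  n | no  _ = trans (*-cong (e-skew n) (others-sym u v))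
                            (solve 2 (λ a b → (:- a) :* b := :- (a :* b)) refl _ _)
    B-skew (just u) nothing  = solve 1 (λ y → y := :- :- y) refl _
    B-skew nothing  (just v) = refl
    B-skew nothing  nothing  = solve 0 (con (+ 0) := :- con (+ 0)) refl

    halve : ∀ y → y + y ≈ 0# → y ≈ 0#
    halve y p = begin
      y                   ≈⟨ *-identityˡ _ ⟨
      1# * y              ≈⟨ *-congʳ (inverse two (char0 1)) ⟨
      two * inv two * y   ≈⟨ solve 2 (λ y i → (con (+ 1) :+ (con (+ 1) :+ con (+ 0))) :* i :* y := i :* (y :+ y)) refl _ _ ⟩
      inv two * (y + y)   ≈⟨ trans (*-congˡ p) (zeroʳ _) ⟩
      0#                  ∎
      where two = fromℕ R 2

    D : ℕ → List (Maybe (Fin m))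
    D zero    = [ nothing ]
    D (suc k) = map just S

    -- One factor 2 per row accumulates to the power of 2 that turns P into Q. The padding row gets
    -- weight 1 because the length does not count it.
    w : ℕ → Maybe (Fin m) → Carrier
    w k (just u) = fromℕ R 2 * factPow R inv a (x u) k
    w k nothing  = 1#

    open Multilinear D w

    weights : List ℕ → List (Fin m) → Carrier
    weights []      us       = 1#
    weights (k ∷ μ) []       = 1#
    weights (k ∷ μ) (u ∷ us) = w k (just u) * weights μ us

    choices-tup : ∀ μ → All (0 <_) μ → ∀ g →
      choices μ g ≈ tup (length μ) S (λ us → weights μ us * g (map just us))
    choices-tup []          []      g = sym (*-identityˡ _)
    choices-tup (suc k ∷ μ) (_ ∷ p) g = trans (∑-map just S _) (∑-cong S λ u → begin
      w (suc k) (just u) * choices μ (λ us → g (just u ∷ us))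
        ≈⟨ *-congˡ (choices-tup μ p _) ⟩
      w (suc k) (just u) * tup (length μ) S (λ us → weights μ us * g (just u ∷ map just us))
        ≈⟨ tup-*ˡ _ (length μ) S _ ⟩
      tup (length μ) S (λ us → w (suc k) (just u) * (weights μ us * g (just u ∷ map just us)))
        ≈⟨ tup-cong (length μ) S (λ us _ → sym (*-assoc _ _ _)) ⟩
      tup (length μ) S (λ us → weights (suc k ∷ μ) (u ∷ us) * g (just u ∷ map just us)) ∎)

    choices-∷ʳ-0 : ∀ μ g → choices (μ ++ [ 0 ]) g ≈ choices μ (λ us → g (us ++ [ nothing ]))
    choices-∷ʳ-0 []      g = trans (+-identityʳ _) (*-identityˡ _)
    choices-∷ʳ-0 (k ∷ μ) g = ∑-cong (D k) (λ u → *-congˡ (choices-∷ʳ-0 μ _))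

    choices-arr : ∀ μ → All (0 <_) μ → ∀ g → (∀ us → Repeats us → g (map just us) ≈ 0#) →
      choices μ g ≈ arr (length μ) S (λ us _ → weights μ us * g (map just us))
    choices-arr μ pos g vanish = begin
      choices μ g
        ≈⟨ choices-tup μ pos g ⟩
      tup (length μ) S G
        ≈⟨ tup-cong (length μ) S (λ us _ → restrict us) ⟩
      tup (length μ) S (λ us → if uniqᵇ us then G us else 0#)
        ≈⟨ tup-unique (length μ) uS G ⟩
      arr (length μ) S (λ us _ → G us) ∎
      where
      G : List (Fin m) → Carrier
      G us = weights μ us * g (map just us)
      restrict : ∀ us → G us ≈ (if uniqᵇ us then G us else 0#)
      restrict us with uniqᵇ us in eq
      ... | true  = refl
      ... | false = trans (*-congˡ (vanish us (¬uniqᵇ⇒Repeats us eq))) (zeroʳ _)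

    weights-partial : ∀ μ us rem → length us ≡ length μ →
      weights μ us * (∏-e (map just us) * ∏ us (λ u → ∏ rem (e u))) ≈ fromℕ R (2 ^ length μ) * partial μ us rem
    weights-partial []      []       rem l =
      solve 0 (con (+ 1) :* (con (+ 1) :* con (+ 1)) := (con (+ 1) :+ con (+ 0)) :* con (+ 1)) refl
    weights-partial (k ∷ μ) (u ∷ us) rem l = begin
      fromℕ R 2 * f * weights μ us * (∏ (map just us) (ê (just u)) * ∏-e (map just us) * (∏ rem (e u) * N))
        ≈⟨ *-congˡ (*-congʳ (*-congʳ (∏-map just us (ê (just u))))) ⟩
      fromℕ R 2 * f * weights μ us * (∏ us (e u) * ∏-e (map just us) * (∏ rem (e u) * N))
        ≈⟨ solve 7 (λ t f w p E q n → t :* f :* w :* (p :* E :* (q :* n)) := t :* (f :* (p :* q)) :* (w :* (E :* n))) refl _ _ _ _ _ _ _ ⟩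
      fromℕ R 2 * (f * (∏ us (e u) * ∏ rem (e u))) * (weights μ us * (∏-e (map just us) * N))
        ≈⟨ *-congˡ (weights-partial μ us rem (ℕ.suc-injective l)) ⟩
      fromℕ R 2 * (f * (∏ us (e u) * ∏ rem (e u))) * (fromℕ R (2 ^ length μ) * partial μ us rem)
        ≈⟨ solve 4 (λ t f p q → t :* f :* (p :* q) := t :* p :* (f :* q)) refl _ _ _ _ ⟩
      fromℕ R 2 * fromℕ R (2 ^ length μ) * partial (k ∷ μ) (u ∷ us) rem
        ≈⟨ *-congʳ (fromℕ-* 2 (2 ^ length μ)) ⟨
      fromℕ R (2 ^ suc (length μ)) * partial (k ∷ μ) (u ∷ us) rem ∎
      where
      f = factPow R inv a (x u) k
      N = ∏ us (λ v → ∏ rem (e v))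

    arr-partial : ∀ μ (g : List (Fin m) → Carrier) →
      (∀ us rem → length us ≡ length μ → us ++ rem ↭ S → g us ≈ ∏-e (map just us) * ∏ us (λ u → ∏ rem (e u))) →
      arr (length μ) S (λ us _ → weights μ us * g us) ≈ Qval R inv a μ m x
    arr-partial μ g hyp = begin
      arr (length μ) S (λ us _ → weights μ us * g us)
        ≈⟨ arr-cong (length μ) S (λ us rem l p → trans (*-congˡ (hyp us rem l p)) (weights-partial μ us rem l)) ⟩
      arr (length μ) S (λ us rem → fromℕ R (2 ^ length μ) * partial μ us rem)
        ≈⟨ arr-*ˡ _ (length μ) S _ ⟨
      fromℕ R (2 ^ length μ) * arr (length μ) S (partial μ)
        ≈⟨ *-congˡ (Pval-arr μ) ⟨
      Qval R inv a μ m x ∎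

    -- The Pfaffian of `B` along an injection `us` that misses the variables `rem`.

    module _ (us rem : List (Fin m)) (us++rem↭S : us ++ rem ↭ S) where

      -- An entry of `B` is a product over all other variables. The factors from `rem` split by row
      -- and column and form the scaling of `pf-schur`; those from the variables hit stay in the
      -- entry.
      scale : Maybe (Fin m) → Carrier
      scale (just u) = ∏ rem (e u)
      scale nothing  = 1#

      unique-us : Unique us
      unique-us = Unique-++ˡ us (Unique-resp-↭ (↭-sym us++rem↭S) uS)

      unique-map : Unique (map just us)
      unique-map = Unique.map⁺ Maybe.just-injective unique-us

      B-just-just : ∀ u v rest → us ↭ u ∷ v ∷ rest → B (just u) (just v) ≈
        e u v * (∏ (map just rest) (λ k → ê (just u) k * ê (just v) k) * (scale (just u) * scale (just v)))
      B-just-just u v rest p with Unique-resp-↭ (↭-sym whole) uS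
        where
        whole : u ∷ v ∷ rest ++ rem ↭ S
        whole = ↭-trans (++⁺ʳ rem (↭-sym p)) us++rem↭S
      ... | (u≢v ∷ _) ∷ uvrest with u Fin.≟ v
      ... | yes q = ⊥-elim (u≢v q)
      ... | no  _ = *-congˡ (begin
        others u v
          ≈⟨ ∏-skip _ uS (↭-trans (++⁺ʳ rem (↭-sym p)) us++rem↭S) ⟩
        ∏ (v ∷ rest ++ rem) (skip v (λ k → e u k * e v k))
          ≈⟨ ∏-skip _ uvrest ↭.refl ⟩
        ∏ (rest ++ rem) (λ k → e u k * e v k)
          ≈⟨ ∏-++ rest rem _ ⟩
        ∏ rest (λ k → e u k * e v k) * ∏ rem (λ k → e u k * e v k)
          ≈⟨ *-cong (sym (∏-map just rest _)) (∏-* rem (e u) (e v)) ⟩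
        ∏ (map just rest) (λ k → ê (just u) k * ê (just v) k) * (∏ rem (e u) * ∏ rem (e v)) ∎)

      pf-even : ∀ h → length us ≡ dbl h → pf B h (map just us) ≈ ∏-e (map just us) * ∏ us (λ u → ∏ rem (e u))
      pf-even h l = trans
        (pf-schur B h (map just us) (≡.trans (List.length-map just us) l) unique-map scale entry)
        (*-congˡ (∏-map just us scale))
        where
        entry : ∀ p q rest → p ∷ q ∷ rest ↭ map just us →
                B p q ≈ ê p q * (∏ rest (λ k → ê p k * ê q k) * (scale p * scale q))
        entry p q rest s with ↭-map-inv just (↭-sym s)
        ... | u ∷ v ∷ rest′ , ≡.refl , t = B-just-just u v rest′ t

      module _ (h : ℕ) (len : length us ≡ suc (dbl h)) where

        padded : List (Maybe (Fin m))
        padded = map just us ++ [ nothing ]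

        padded↭ : nothing ∷ map just us ↭ padded
        padded↭ = ∷↭∷ʳ nothing (map just us)

        unique-padded : Unique padded
        unique-padded = Unique-resp-↭ padded↭ (All.map⁺ (All.universal (λ _ ()) us) ∷ unique-map)

        ∏-neg-even : ∀ h′ (vs : List (Fin m)) → length vs ≡ dbl h′ → ∏ vs (λ _ → - 1#) ≈ 1#
        ∏-neg-even zero     []           l = refl
        ∏-neg-even (suc h′) (_ ∷ _ ∷ vs) l = trans
          (*-congˡ (*-congˡ (∏-neg-even h′ vs (ℕ.suc-injective (ℕ.suc-injective l)))))
          (solve 0 ((:- con (+ 1)) :* ((:- con (+ 1)) :* con (+ 1)) := con (+ 1)) refl)

        -- Every `ê nothing k` is -1, and besides `u` an even number of variables is hit, so the
        -- signs multiply to 1. This is where the odd length enters.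
        B-just-nothing : ∀ u rest → just u ∷ rest ↭ map just us →
          B (just u) nothing ≈ 1# * (∏ rest (λ k → ê (just u) k * ê nothing k) * (scale (just u) * 1#))
        B-just-nothing u rest s with ↭-map-inv just (↭-sym s)
        ... | u ∷ rest′ , ≡.refl , t = begin
          ∏ S (skip u (e u))
            ≈⟨ ∏-skip (e u) uS (↭-trans (++⁺ʳ rem (↭-sym t)) us++rem↭S) ⟩
          ∏ (rest′ ++ rem) (e u)
            ≈⟨ ∏-++ rest′ rem (e u) ⟩
          ∏ rest′ (e u) * ∏ rem (e u)
            ≈⟨ solve 2 (λ a b → a :* b := con (+ 1) :* ((a :* con (+ 1)) :* (b :* con (+ 1)))) refl _ _ ⟩
          1# * ((∏ rest′ (e u) * 1#) * (∏ rem (e u) * 1#))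
            ≈⟨ *-congˡ (*-congʳ (*-congˡ (∏-neg-even h rest′ (ℕ.suc-injective (≡.trans (≡.sym (↭-length t)) len))))) ⟨
          1# * ((∏ rest′ (e u) * ∏ rest′ (λ _ → - 1#)) * (∏ rem (e u) * 1#))
            ≈⟨ *-congˡ (*-congʳ (trans (sym (∏-* rest′ (e u) _)) (sym (∏-map just rest′ _)))) ⟩
          1# * (∏ (map just rest′) (λ k → ê (just u) k * ê nothing k) * (∏ rem (e u) * 1#)) ∎

        entry : ∀ p q rest → p ∷ q ∷ rest ↭ padded →
                B p q ≈ ê p q * (∏ rest (λ k → ê p k * ê q k) * (scale p * scale q))
        entry (just u) nothing  rest s =
          B-just-nothing u rest (drop-∷ (↭-trans (swap nothing (just u) ↭.refl) (↭-trans s (↭-sym padded↭))))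
        entry nothing  (just v) rest s = begin
          - B (just v) nothing
            ≈⟨ -‿cong (B-just-nothing v rest (drop-∷ (↭-trans s (↭-sym padded↭)))) ⟩
          - (1# * (∏ rest (λ k → ê (just v) k * ê nothing k) * (scale (just v) * 1#)))
            ≈⟨ -‿cong (*-congˡ (*-congʳ (∏-cong rest (λ _ → *-comm _ _)))) ⟩
          - (1# * (∏ rest (λ k → ê nothing k * ê (just v) k) * (scale (just v) * 1#)))
            ≈⟨ solve 2 (λ a b → :- (con (+ 1) :* (a :* (b :* con (+ 1)))) := (:- con (+ 1)) :* (a :* (con (+ 1) :* b))) refl _ _ ⟩
          - 1# * (∏ rest (λ k → ê nothing k * ê (just v) k) * (1# * scale (just v))) ∎
        entry nothing  nothing  rest s with Unique-resp-↭ (↭-sym s) unique-padded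
        ... | (n ∷ _) ∷ _ = ⊥-elim (n ≡.refl)
        -- Neither chosen index is `nothing`, so `nothing` lies in `rest`, where it contributes the
        -- factor `1# * 1#`; without it the entry is the one already computed.
        entry (just u) (just v) rest s with ∈-resp-↭ (↭-sym (↭-trans s (↭-sym padded↭))) (here ≡.refl)
        ... | there (there nothing∈rest) with ∈-∃++ nothing∈rest
        ... | ys , zs , ≡.refl with ↭-map-inv just (↭-sym without)
          where
          without : just u ∷ just v ∷ ys ++ zs ↭ map just us
          without = drop-∷ (↭-trans
            (↭-trans (swap nothing (just u) ↭.refl) (prep (just u)
              (↭-trans (swap nothing (just v) ↭.refl) (prep (just v) (↭-sym (shift nothing ys zs))))))
            (↭-trans s (↭-sym padded↭)))
        ... | u ∷ v ∷ rest′ , eq , t with List.∷-injective eq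
        ... | ≡.refl , eq′ with List.∷-injective eq′
        ... | ≡.refl , eq″ = begin
          B (just u) (just v)
            ≈⟨ B-just-just u v rest′ t ⟩
          e u v * (∏ (map just rest′) F * (scale (just u) * scale (just v)))
            ≈⟨ *-congˡ (*-congʳ (trans
                 (solve 1 (λ y → y := con (+ 1) :* con (+ 1) :* y) refl _)
                 (trans (*-congˡ (reflexive (cong (λ l → ∏ l F) (≡.sym eq″)))) (sym (∏-↭ F (shift nothing ys zs)))))) ⟩
          e u v * (∏ (ys ++ nothing ∷ zs) F * (scale (just u) * scale (just v))) ∎
          where
          F : Maybe (Fin m) → Carrier
          F k = ê (just u) k * ê (just v) k

        ∏-e-padded : ∀ vs → ∏-e (map just vs ++ [ nothing ]) ≈ ∏-e (map just vs)
        ∏-e-padded []       = *-identityˡ _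
        ∏-e-padded (v ∷ vs) = *-cong
          (trans (∏-++ (map just vs) [ nothing ] _) (trans (*-congˡ (*-identityˡ _)) (*-identityʳ _)))
          (∏-e-padded vs)

        pf-odd : pf B (suc h) padded ≈ ∏-e (map just us) * ∏ us (λ u → ∏ rem (e u))
        pf-odd = trans
          (pf-schur B (suc h) padded
            (≡.trans (↭-length (↭-sym padded↭)) (cong suc (≡.trans (List.length-map just us) len)))
            unique-padded scale entry)
          (*-cong (∏-e-padded us)
            (trans (∏-++ (map just us) [ nothing ] scale)
              (trans (*-cong (∏-map just us scale) (*-identityˡ _)) (*-identityʳ _))))

    -- The evaluated Pfaffians are Q-functions, and the theorem follows.

    choices-even : ∀ μ → All (0 <_) μ → ∀ h → length μ ≡ dbl h →
                   choices μ (pf B h) ≈ Qval R inv a μ m x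
    choices-even μ pos h l = trans
      (choices-arr μ pos (pf B h) (λ us rep → pf-repeats B B-skew halve h (Repeats-map just rep)))
      (arr-partial μ (λ us → pf B h (map just us)) (λ us rem lu p → pf-even us rem p h (≡.trans lu l)))

    choices-odd : ∀ μ → All (0 <_) μ → ∀ h → length μ ≡ suc (dbl h) →
                  choices (μ ++ [ 0 ]) (pf B (suc h)) ≈ Qval R inv a μ m x
    choices-odd μ pos h l = trans (choices-∷ʳ-0 μ _) (trans
      (choices-arr μ pos (λ us → pf B (suc h) (us ++ [ nothing ])) (λ us rep → pf-repeats B B-skew halve (suc h) (Repeats-++ˡ (Repeats-map just rep))))
      (arr-partial μ (λ us → pf B (suc h) (map just us ++ [ nothing ])) (λ us rem lu p → pf-odd us rem p h (≡.trans lu l))))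

    -- The entries are the smallest instances of the evaluation itself: a partition with two parts,
    -- or one with a single part padded by 0.
    Qpair-choices : ∀ k l → l < k → Qpair R inv a k l m x ≈ choices (k ∷ l ∷ []) (pf B 1)
    Qpair-choices (suc k) zero    p = sym (choices-odd (suc k ∷ []) (s≤s z≤n ∷ []) 0 ≡.refl)
    Qpair-choices (suc k) (suc l) p rewrite <ᵇ-true p =
      sym (choices-even (suc k ∷ suc l ∷ []) (s≤s z≤n ∷ s≤s z≤n ∷ []) 1 ≡.refl)

    Qpair-∑ : ∀ k l → l < k → Qpair R inv a k l m x ≈
              ∑ (D k) (λ u → ∑ (D l) (λ v → w k u * (w l v * B u v)))
    Qpair-∑ k l p = trans (Qpair-choices k l p) (∑-cong (D k) λ u → trans (∑-*ˡ (w k u) (D l) _)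
      (∑-cong (D l) λ v → *-congˡ (*-congˡ
        (solve 1 (λ b → b :* con (+ 1) :- con (+ 0) := b) refl _))))

    Q-Pf : ∀ μ → StrictPartition μ → Qval R inv a μ m x ≈
           Pf R (suc (length μ) / 2) (λ i j → Qpair R inv a (nth μ i) (nth μ j) m x)
    Q-Pf μ (linked , pos) with even-or-odd (length μ)
    ... | h , inj₁ l = begin
      Qval R inv a μ m x                    ≈⟨ choices-even μ pos h l ⟨
      choices μ (pf B h)                    ≈⟨ pf-choices Q B h l (AllPairs.map (λ {k} {l} → Qpair-∑ k l) strict) ⟨
      pf Q h μ                              ≡⟨ cong (pf Q h) parts ⟨
      pf Q h (map (nth μ) (ix (2 ℕ.* h)))   ≈⟨ pf-map (nth μ) Q h _ ⟨
      pf (λ i j → Q (nth μ i) (nth μ j)) h (ix (2 ℕ.* h)) ≈⟨ Pf-pf _ h ⟨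
      Pf R h (λ i j → Q (nth μ i) (nth μ j)) ≡⟨ cong (λ n → Pf R n (λ i j → Q (nth μ i) (nth μ j)))
                                                 (≡.trans (cong (λ n → suc n / 2) l) ([1+dbl]/2 h)) ⟨
      Pf R (suc (length μ) / 2) (λ i j → Q (nth μ i) (nth μ j)) ∎
      where
      Q : ℕ → ℕ → Carrier
      Q k l = Qpair R inv a k l m x
      strict = Linked⇒AllPairs (λ p q → ℕ.<-trans q p) linked
      parts : map (nth μ) (ix (2 ℕ.* h)) ≡ μ
      parts = ≡.trans (cong (λ n → map (nth μ) (ix n)) (≡.trans (2*≡dbl h) (≡.sym l))) (map-nth-ix μ)
    ... | h , inj₂ l = begin
      Qval R inv a μ m x                      ≈⟨ choices-odd μ pos h l ⟨
      -- The parts are positive, so the list padded by 0 is still strictly decreasing and each entry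
      -- above the diagonal is covered by `Qpair-∑`.
      choices (μ ++ [ 0 ]) (pf B (suc h))     ≈⟨ pf-choices Q B (suc h) l′ (AllPairs.map (λ {k} {l} → Qpair-∑ k l) strict) ⟨
      pf Q (suc h) (μ ++ [ 0 ])               ≡⟨ cong (pf Q (suc h)) parts ⟨
      pf Q (suc h) (map (nth μ) (ix (2 ℕ.* suc h))) ≈⟨ pf-map (nth μ) Q (suc h) (ix (2 ℕ.* suc h)) ⟨
      pf (λ i j → Q (nth μ i) (nth μ j)) (suc h) (ix (2 ℕ.* suc h)) ≈⟨ Pf-pf _ (suc h) ⟨
      Pf R (suc h) (λ i j → Q (nth μ i) (nth μ j)) ≡⟨ cong (λ n → Pf R n (λ i j → Q (nth μ i) (nth μ j)))
                                                       (≡.trans (cong (λ n → suc n / 2) l) (dbl/2 (suc h))) ⟨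
      Pf R (suc (length μ) / 2) (λ i j → Q (nth μ i) (nth μ j)) ∎
      where
      Q : ℕ → ℕ → Carrier
      Q k l = Qpair R inv a k l m x
      l′ : length (μ ++ [ 0 ]) ≡ dbl (suc h)
      l′ = ≡.trans (List.length-++ μ) (≡.trans (ℕ.+-comm (length μ) 1) (cong suc l))
      pad : ∀ {μ} → AllPairs (λ p q → q < p) μ → All (0 <_) μ → AllPairs (λ p q → q < p) (μ ++ [ 0 ])
      pad []       []      = [] ∷ []
      pad (p ∷ ps) (q ∷ qs) = All.++⁺ p (q ∷ []) ∷ pad ps qs
      strict = pad (Linked⇒AllPairs (λ p q → ℕ.<-trans q p) linked) pos
      parts : map (nth μ) (ix (2 ℕ.* suc h)) ≡ μ ++ [ 0 ]
      parts = ≡.trans (cong (λ n → map (nth μ) (ix n)) (≡.trans (2*≡dbl (suc h)) (cong suc (≡.sym l)))) (map-nth-ix-suc μ)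

theorem9p1 : {c ℓ : Level} (R : CommutativeRing c ℓ) →
    let open CommutativeRing R in
    (inv : Carrier → Carrier) →
    (∀ y → ¬ (y ≈ 0#) → y * inv y ≈ 1#) →
    (∀ n → ¬ (fromℕ R (suc n) ≈ 0#)) →
    (a : ℕ → Carrier) → a 1 ≈ 0# →
    (μ : List ℕ) → StrictPartition μ →
    (m : ℕ) → (x : Fin m → Carrier) → (∀ i j → x i ≈ x j → i ≡ j) →
    Qval R inv a μ m x ≈
    Pf R (suc (length μ) / 2)
    (λ i j → Qpair R inv a (nth μ i) (nth μ j) m x)
theorem9p1 R inv inverse char0 a _ μ strict m x x-inj =
  QFunctions.Evaluation.Q-Pf R inv inverse char0 a x x-inj μ strict
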